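{- The satisfiability problem for \text{DPLDL} (given a \text{DPLDL} formula, decide whether it has a model) is undecidable.
   Context: Let $P$ be a finite set of atomic propositions and $\Sigma=2^P$. Deterministic Pushdown Linear Dynamic Logic (\text{DPLDL}) is obtained from \text{VLDL} by replacing the visibly pushdown automata guarding the temporal operators by deterministic pushdown automata (DPDA) over $\Sigma$ (on finite words, possibly equipped with tests). Formulas: $\varphi ::= p \mid \neg\varphi\mid\varphi\wedge\varphi\mid\varphi\vee\varphi\mid\langle\mathfrak A\rangle\varphi\mid[\mathfrak A]\varphi$, $p\in P$, $\mathfrak A$ a DPDA (with a function $t$ mapping its states to \text{DPLDL} formulas, acyclic nesting; states without test are mapped to a tautology). For $\alpha=\alpha_0\alpha_1\cdots\in\Sigma^\omega$ and $k\in\mathbb N$: $(\alpha,k)\models p$ iff $p\in\alpha_k$; Boolean connectives as usual; $\mathcal R_{\mathfrak A}(\alpha)$ is the set of pairs $(k,l)$ such that $\mathfrak A$ has an initial accepting run on the finite infix $\alpha_k\cdots\alpha_{l-1}$ whose state at each position $m\in\{k,\dots,l\}$ has a test satisfied at $(\alpha,m)$; $(\alpha,k)\models\langle\mathfrak A\rangle\varphi$ iff some $l\ge k$ with $(k,l)\in\mathcal R_{\mathfrak A}(\alpha)$ has $(\alpha,l)\models\varphi$; $(\alpha,k)\models[\mathfrak A]\varphi$ iff all $l\ge k$ with $(k,l)\in\mathcal R_{\mathfrak A}(\alpha)$ satisfy $(\alpha,l)\models\varphi$. A model of $\varphi$ is an $\alpha$ with $(\alpha,0)\models\varphi$. -}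

module Defs where

open import Data.Nat using (ℕ; zero; suc; _+_; _*_; _^_; _≤_; _<_; _≡ᵇ_)
open import Data.Fin using (Fin; toℕ)
open import Data.Bool using (Bool; true; false; if_then_else_)
open import Data.Maybe using (Maybe; just; nothing)
open import Data.List using (List; []; _∷_; _++_)
open import Data.List.Membership.Propositional using (_∈_)
open import Data.Vec using (Vec; []; _∷_; lookup)
open import Data.Product using (Σ; _×_; _,_)
open import Data.Sum using (_⊎_)
open import Data.Unit using (⊤)
open import Data.Empty using (⊥)
open import Relation.Nullary using (¬_)
open import Relation.Binary.PropositionalEquality using (_≡_; _≢_)

-- Syntax of DPLDL over P = Fin n, alphabet Σ = 2^P = Vec Bool n.
--
-- A pushdown automaton is given by
--   initial state q0, initial stack symbol Z0, list of final states,
--   a list of transition rules, and a list of tests (state , formula).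
-- States and stack symbols are natural numbers (only the finitely many
-- occurring in the automaton matter).  A rule
--   rule q a X q' γ    (a : Maybe letter; nothing = ε-move)
-- means: in state q with X on top of the stack, reading a (or nothing),
-- go to q' and replace X by the word γ (head of γ = new top).
-- The test of a state q is the formula of the first entry (q , ψ) of
-- the test list; states without entry are mapped to a tautology.
-- Acyclic nesting of tests is automatic (inductive definition).

Letter : ℕ → Set
Letter n = Vec Bool n

data Rule (n : ℕ) : Set where
  rule : (src : ℕ) (inp : Maybe (Letter n)) (top : ℕ)
         (tgt : ℕ) (push : List ℕ) → Rule n

mutual
  data Formula (n : ℕ) : Set where
    atom : Fin n → Formula n
    ¬f_  : Formula n → Formula n
    _∧f_ : Formula n → Formula n → Formula n
    _∨f_ : Formula n → Formula n → Formula n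
    ⟨_⟩_ : PDA n → Formula n → Formula n
    [_]_ : PDA n → Formula n → Formula n

  data PDA (n : ℕ) : Set where
    pda : (q0 : ℕ) (Z0 : ℕ) (finals : List ℕ) (rules : List (Rule n))
          (tests : List (ℕ × Formula n)) → PDA n

data TwoRules {A : Set} : List A → A → A → Set where
  here  : ∀ {x xs y} → y ∈ xs → TwoRules (x ∷ xs) x y
  here' : ∀ {x xs y} → y ∈ xs → TwoRules (x ∷ xs) y x
  there : ∀ {x xs y z} → TwoRules xs y z → TwoRules (x ∷ xs) y z

-- Two distinct rules with the same source state and stack top must both
-- read an input letter, and these letters must differ.  (So: at most one
-- move per (state, letter, top), and no ε-move coexisting with any other
-- move for the same (state, top).)
Compatible : ∀ {n} → Rule n → Rule n → Set
Compatible (rule q a X _ _) (rule q' a' X' _ _) =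
  q ≡ q' → X ≡ X' → Σ (Letter _) λ b → Σ (Letter _) λ b' →
    (a ≡ just b) × (a' ≡ just b') × (b ≢ b')

DeterministicRules : ∀ {n} → List (Rule n) → Set
DeterministicRules rs = ∀ r r' → TwoRules rs r r' → Compatible r r'

mutual
  WF : ∀ {n} → Formula n → Set
  WF (atom _)  = ⊤
  WF (¬f φ)    = WF φ
  WF (φ ∧f ψ)  = WF φ × WF ψ
  WF (φ ∨f ψ)  = WF φ × WF ψ
  WF (⟨ A ⟩ φ) = WFA A × WF φ
  WF ([ A ] φ) = WFA A × WF φ

  WFA : ∀ {n} → PDA n → Set
  WFA (pda _ _ _ rs ts) = DeterministicRules rs × WFT ts

  WFT : ∀ {n} → List (ℕ × Formula n) → Set
  WFT []            = ⊤
  WFT ((_ , φ) ∷ ts) = WF φ × WFT ts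

Word : ℕ → Set
Word n = ℕ → Letter n

-- configurations: state, stack, position in α
Config : Set
Config = ℕ × List ℕ × ℕ

data Step {n} (rs : List (Rule n)) (α : Word n) : Config → Config → Set where
  read : ∀ {q X q' γ s m} → rule q (just (α m)) X q' γ ∈ rs →
         Step rs α (q , X ∷ s , m) (q' , γ ++ s , suc m)
  eps  : ∀ {q X q' γ s m} → rule q nothing X q' γ ∈ rs →
         Step rs α (q , X ∷ s , m) (q' , γ ++ s , m)

data Run {n} (rs : List (Rule n)) (α : Word n) (T : ℕ → ℕ → Set)
     : Config → Config → Set where
  done : ∀ {q s m} → T q m → Run rs α T (q , s , m) (q , s , m)
  step : ∀ {q s m c d} → T q m → Step rs α (q , s , m) c → Run rs α T c d →
         Run rs α T (q , s , m) d

mutual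
  _,_⊨_ : ∀ {n} → Word n → ℕ → Formula n → Set
  α , k ⊨ atom p    = lookup (α k) p ≡ true
  α , k ⊨ (¬f φ)    = ¬ (α , k ⊨ φ)
  α , k ⊨ (φ ∧f ψ)  = (α , k ⊨ φ) × (α , k ⊨ ψ)
  α , k ⊨ (φ ∨f ψ)  = (α , k ⊨ φ) ⊎ (α , k ⊨ ψ)
  α , k ⊨ (⟨ pda q0 Z0 F rs ts ⟩ φ) =
    Σ ℕ λ l → k ≤ l × InR q0 Z0 F rs (Test α ts) α k l × (α , l ⊨ φ)
  α , k ⊨ ([ pda q0 Z0 F rs ts ] φ) =
    ∀ l → k ≤ l → InR q0 Z0 F rs (Test α ts) α k l → α , l ⊨ φ

  Test : ∀ {n} → Word n → List (ℕ × Formula n) → ℕ → ℕ → Set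
  Test α []             q m = ⊤
  Test α ((q' , ψ) ∷ ts) q m = if q ≡ᵇ q' then (α , m ⊨ ψ) else Test α ts q m

  -- (k , l) ∈ R_A(α): an initial accepting run on α_k ⋯ α_{l-1}
  InR : ∀ {n} → ℕ → ℕ → List ℕ → List (Rule n) → (ℕ → ℕ → Set) →
        Word n → ℕ → ℕ → Set
  InR q0 Z0 F rs T α k l =
    Σ ℕ λ qf → Σ (List ℕ) λ s → qf ∈ F × Run rs α T (q0 , Z0 ∷ [] , k) (qf , s , l)

Satisfiable : ∀ {n} → Formula n → Set
Satisfiable {n} φ = Σ (Word n) λ α → α , 0 ⊨ φ

data Code : ℕ → Set where
  zer  : ∀ {k} → Code k
  suc′ : Code 1
  proj : ∀ {k} → Fin k → Code k
  comp : ∀ {k m} → Code m → Vec (Code k) m → Code k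
  prec : ∀ {k} → Code k → Code (suc (suc k)) → Code (suc k)
  mu   : ∀ {k} → Code (suc k) → Code k

mutual
  data Eval : ∀ {k} → Code k → Vec ℕ k → ℕ → Set where
    ezer  : ∀ {k} {xs : Vec ℕ k} → Eval zer xs 0
    esuc  : ∀ {x} → Eval suc′ (x ∷ []) (suc x)
    eproj : ∀ {k} {i : Fin k} {xs} → Eval (proj i) xs (lookup xs i)
    ecomp : ∀ {k m} {f : Code m} {gs : Vec (Code k) m} {xs ys v} →
            EvalV gs xs ys → Eval f ys v → Eval (comp f gs) xs v
    eprec0 : ∀ {k} {f : Code k} {g} {xs v} →
             Eval f xs v → Eval (prec f g) (0 ∷ xs) v
    eprecS : ∀ {k} {f : Code k} {g} {xs y w v} →
             Eval (prec f g) (y ∷ xs) w → Eval g (y ∷ w ∷ xs) v →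
             Eval (prec f g) (suc y ∷ xs) v
    emu   : ∀ {k} {f : Code (suc k)} {xs n} →
            Eval f (n ∷ xs) 0 →
            (∀ m → m < n → Σ ℕ λ v → Eval f (m ∷ xs) (suc v)) →
            Eval (mu f) xs n

  data EvalV : ∀ {k m} → Vec (Code k) m → Vec ℕ k → Vec ℕ m → Set where
    []  : ∀ {k} {xs : Vec ℕ k} → EvalV [] xs []
    _∷_ : ∀ {k m} {g : Code k} {gs : Vec (Code k) m} {xs y ys} →
          Eval g xs y → EvalV gs xs ys → EvalV (g ∷ gs) xs (y ∷ ys)

pair : ℕ → ℕ → ℕ
pair a b = 2 ^ a * suc (2 * b)

encBool : Bool → ℕ
encBool false = 0
encBool true  = 1

encLetter : ∀ {n} → Letter n → ℕ
encLetter []       = 0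
encLetter (b ∷ bs) = suc (pair (encBool b) (encLetter bs))

encNats : List ℕ → ℕ
encNats []       = 0
encNats (x ∷ xs) = suc (pair x (encNats xs))

encMaybe : ∀ {n} → Maybe (Letter n) → ℕ
encMaybe nothing  = 0
encMaybe (just a) = suc (encLetter a)

encRule : ∀ {n} → Rule n → ℕ
encRule (rule q a X q' γ) =
  pair q (pair (encMaybe a) (pair X (pair q' (encNats γ))))

encRules : ∀ {n} → List (Rule n) → ℕ
encRules []       = 0
encRules (r ∷ rs) = suc (pair (encRule r) (encRules rs))

mutual
  encF : ∀ {n} → Formula n → ℕ
  encF (atom p)  = pair 0 (toℕ p)
  encF (¬f φ)    = pair 1 (encF φ)
  encF (φ ∧f ψ)  = pair 2 (pair (encF φ) (encF ψ))
  encF (φ ∨f ψ)  = pair 3 (pair (encF φ) (encF ψ))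
  encF (⟨ A ⟩ φ) = pair 4 (pair (encA A) (encF φ))
  encF ([ A ] φ) = pair 5 (pair (encA A) (encF φ))

  encA : ∀ {n} → PDA n → ℕ
  encA (pda q0 Z0 F rs ts) =
    pair q0 (pair Z0 (pair (encNats F) (pair (encRules rs) (encT ts))))

  encT : ∀ {n} → List (ℕ × Formula n) → ℕ
  encT []             = 0
  encT ((q , φ) ∷ ts) = suc (pair (pair q (encF φ)) (encT ts))

⌜_,_⌝ : (n : ℕ) → Formula n → ℕ
⌜ n , φ ⌝ = pair n (encF φ)

DecidesDPLDLSat : Code 1 → Set
DecidesDPLDLSat c =
  ∀ n (φ : Formula n) → WF φ →
    (Satisfiable φ × Eval c (⌜ n , φ ⌝ ∷ []) 1) ⊎
    (¬ Satisfiable φ × Eval c (⌜ n , φ ⌝ ∷ []) 0)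

-- A derivation of Eval f xs v is written as a word of blocks: a block carries a label naming a
-- node of f and holds natural numbers in unary.  One deterministic pushdown automaton compares a
-- number of the current block with a number of the next block bearing a given label, so "every
-- block is justified by later blocks" is a formula.  Soundness is structural induction on the
-- code, and every derivation gives such a word because the nodes have pairwise distinct labels.
--
-- Undecidability then follows by diagonalisation.  If c decides satisfiability, let the template
-- say that c, applied to the number of the formula "template and the input is x" for the input x
-- written at the start of the word, returns 0; with x the number of the template itself, this
-- formula is satisfiable exactly when c rejects it.

module Submission where

open import Defs
open import Data.Bool using (Bool; true; false; T; not; _∧_; if_then_else_)
open import Data.Empty using (⊥-elim)
open import Data.Fin using (Fin; toℕ) renaming (zero to fzero; suc to fsuc)
open import Data.List using (List; []; _∷_; _++_; map; replicate; upTo; cartesianProduct; tabulate)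
open import Data.List.Properties using (++-identityʳ)
open import Data.List.Membership.Propositional using (_∈_)
open import Data.List.Membership.Propositional.Properties using (∈-map⁺; ∈-map⁻; ∈-++⁺ˡ; ∈-++⁺ʳ; ∈-upTo⁺; ∈-cartesianProduct⁺; ∈-cartesianProduct⁻; ∈-upTo⁻)
open import Data.List.Relation.Unary.All as All using (All; []; _∷_)
open import Data.List.Relation.Unary.All.Properties as Allₚ using ()
open import Data.List.Relation.Unary.AllPairs as AllPairs using (AllPairs; []; _∷_)
open import Data.List.Relation.Unary.AllPairs.Properties as AllPairsₚ using ()
open import Data.List.Relation.Unary.Any as Any using (Any; here; there)
open import Data.List.Relation.Unary.Unique.Propositional using (Unique)
open import Data.List.Relation.Unary.Unique.Propositional.Properties as Uniqueₚ using ()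
open import Data.Maybe using (Maybe; just; nothing)
open import Data.Nat using (ℕ; zero; suc; _+_; _*_; _^_; _≤_; _<_; z≤n; s≤s; s≤s⁻¹; _≡ᵇ_)
open import Data.Nat.ListAction using (sum)
open import Data.Nat.Properties
open import Data.Product using (Σ; _×_; _,_; proj₁; proj₂)
open import Data.Sum using (_⊎_; inj₁; inj₂)
open import Data.Unit using (⊤; tt)
open import Data.Vec as Vec using (Vec; []; _∷_; lookup; toList)
open import Function using (_∘_)
open import Relation.Nullary using (¬_; contradiction)
open import Relation.Binary.Definitions using (tri<; tri≈; tri>)
open import Relation.Binary.PropositionalEquality using (_≡_; _≢_; refl; sym; trans; cong; cong₂; subst)

-- An automaton has one stack and so checks one equation between two numbers. What a block needs is
-- a conjunction of such equations, and the conjuncts speak of the same later block because the next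
-- block with a given label is unique. A word is infinite and may contain endless chains of blocks,
-- so soundness never appeals to an end of the word: where a block calls its own label again, a
-- number decreases. The diagonal step threatens a circle. The number of propositions must exceed
-- every label of the simulated code, while this code computes a formula number in which the number
-- of propositions occurs; written into the code as a numeral, it would add labels. Hence that
-- number, and the numbers of the other fixed parts of the formula, are extra arguments of the code.
-- The template prescribes them as constants that an automaton pushes in one move, at no cost in
-- labels or registers.

-- Deterministic automata given by transition tables, and their runs.

allLetters : ∀ n → List (Letter n)
allLetters zero    = [] ∷ []
allLetters (suc n) = map (true ∷_) (allLetters n) ++ map (false ∷_) (allLetters n)

∈-allLetters : ∀ {n} (a : Letter n) → a ∈ allLetters n
∈-allLetters []          = here refl
∈-allLetters (true ∷ a)  = ∈-++⁺ˡ (∈-map⁺ (true ∷_) (∈-allLetters a))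
∈-allLetters (false ∷ a) = ∈-++⁺ʳ _ (∈-map⁺ (false ∷_) (∈-allLetters a))

allLetters-unique : ∀ n → Unique (allLetters n)
allLetters-unique zero    = [] ∷ []
allLetters-unique (suc n) =
  Uniqueₚ.++⁺ (Uniqueₚ.map⁺ (λ { refl → refl }) (allLetters-unique n))
              (Uniqueₚ.map⁺ (λ { refl → refl }) (allLetters-unique n))
              disjoint
  where
  disjoint : ∀ {a} → ¬ (a ∈ map (true ∷_) (allLetters n) × a ∈ map (false ∷_) (allLetters n))
  disjoint (p , q) with ∈-map⁻ (true ∷_) p | ∈-map⁻ (false ∷_) q
  ... | _ , _ , refl | _ , _ , ()

Transition : ℕ → Set
Transition n = ℕ → Letter n → ℕ → ℕ × List ℕ

Key : ℕ → Set
Key n = ℕ × Letter n × ℕ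

-- Every automaton below has states 0, …, 4, stack symbols 0 (bottom) and 1, and no ε-moves.
keys : ∀ n → List (Key n)
keys n = cartesianProduct (upTo 5) (cartesianProduct (allLetters n) (upTo 2))

keys-unique : ∀ n → Unique (keys n)
keys-unique n =
  Uniqueₚ.cartesianProduct⁺ (Uniqueₚ.upTo⁺ 5)
    (Uniqueₚ.cartesianProduct⁺ (allLetters-unique n) (Uniqueₚ.upTo⁺ 2))

toRule : ∀ {n} → Transition n → Key n → Rule n
toRule δ (q , a , X) = rule q (just a) X (proj₁ (δ q a X)) (proj₂ (δ q a X))

rulesOf : ∀ {n} → Transition n → List (Rule n)
rulesOf {n} δ = map (toRule δ) (keys n)

automaton : ∀ {n} → Transition n → ℕ → PDA n
automaton δ qf = pda 0 0 (qf ∷ []) (rulesOf δ) []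

twoRules-allPairs : ∀ {A : Set} {R : A → A → Set} {xs x y} →
                    AllPairs (λ a b → R a b × R b a) xs → TwoRules xs x y → R x y
twoRules-allPairs (r ∷ _) (here i)  = proj₁ (All.lookup r i)
twoRules-allPairs (r ∷ _) (here' i) = proj₂ (All.lookup r i)
twoRules-allPairs (_ ∷ rs) (there t) = twoRules-allPairs rs t

toRule-compatible : ∀ {n} (δ : Transition n) k k' → k ≢ k' → Compatible (toRule δ k) (toRule δ k')
toRule-compatible δ (q , a , X) (q' , a' , X') k≢k' q≡q' X≡X' =
  a , a' , refl , refl , λ a≡a' → k≢k' (cong₂ _,_ q≡q' (cong₂ _,_ a≡a' X≡X'))

-- The table has exactly one rule per key, so two of its rules have different keys; with equal state
-- and top they can differ only in the letter.
rulesOf-deterministic : ∀ {n} (δ : Transition n) → DeterministicRules (rulesOf δ)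
rulesOf-deterministic {n} δ r r' =
  twoRules-allPairs {R = Compatible} (AllPairsₚ.map⁺ (AllPairs.map both (keys-unique n)))
  where
  both : ∀ {k k'} → k ≢ k' → Compatible (toRule δ k) (toRule δ k') × Compatible (toRule δ k') (toRule δ k)
  both {k} {k'} ne = toRule-compatible δ k k' ne , toRule-compatible δ k' k (ne ∘ sym)

-- A run of rulesOf δ whose final state is qf.
data Path {n} (δ : Transition n) (α : Word n) (qf : ℕ) : ℕ → List ℕ → ℕ → ℕ → Set where
  stop : ∀ {s k} → Path δ α qf qf s k k
  move : ∀ {q X s k l} → q < 5 → X < 2 →
         Path δ α qf (proj₁ (δ q (α k) X)) (proj₂ (δ q (α k) X) ++ s) (suc k) l →
         Path δ α qf q (X ∷ s) k l

moveTo : ∀ {n} {δ : Transition n} {α qf q X s k l q' γ} → q < 5 → X < 2 → δ q (α k) X ≡ (q' , γ) →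
         Path δ α qf q' (γ ++ s) (suc k) l → Path δ α qf q (X ∷ s) k l
moveTo q<5 X<2 refl p = move q<5 X<2 p

path-≤ : ∀ {n} {δ : Transition n} {α qf q s k l} → Path δ α qf q s k l → k ≤ l
path-≤ stop         = ≤-refl
path-≤ (move _ _ p) = <⇒≤ (path-≤ p)

path⇒run : ∀ {n} {δ : Transition n} {α qf q s k l} → Path δ α qf q s k l →
           Σ (List ℕ) λ s' → Run (rulesOf δ) α (Test α []) (q , s , k) (qf , s' , l)
path⇒run stop = _ , done tt
path⇒run {δ = δ} {α} (move {k = k} q<5 X<2 p) with path⇒run p
... | _ , r = _ , step tt (read (∈-map⁺ (toRule δ)
                  (∈-cartesianProduct⁺ (∈-upTo⁺ q<5)
                    (∈-cartesianProduct⁺ (∈-allLetters (α k)) (∈-upTo⁺ X<2))))) r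

run⇒path : ∀ {n} {δ : Transition n} {α q s k qf s' l} →
           Run (rulesOf δ) α (Test α []) (q , s , k) (qf , s' , l) → Path δ α qf q s k l
run⇒path (done _) = stop
run⇒path {n} {δ} (step _ (read r∈) r) with ∈-map⁻ (toRule δ) r∈
... | k , k∈ , refl with ∈-cartesianProduct⁻ (upTo 5) (cartesianProduct (allLetters n) (upTo 2)) k∈
... | q∈ , aX∈ with ∈-cartesianProduct⁻ (allLetters n) (upTo 2) aX∈
... | _ , X∈ = move (∈-upTo⁻ q∈) (∈-upTo⁻ X∈) (run⇒path r)
run⇒path {δ = δ} (step _ (eps r∈) r) with ∈-map⁻ (toRule δ) r∈
... | _ , _ , ()

Accepts : ∀ {n} → Transition n → ℕ → Word n → ℕ → ℕ → Set
Accepts δ qf α k l = Path δ α qf 0 (0 ∷ []) k l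

⟨⟩-intro : ∀ {n} {δ : Transition n} {qf α k l φ} → Accepts δ qf α k l → α , l ⊨ φ →
           α , k ⊨ (⟨ automaton δ qf ⟩ φ)
⟨⟩-intro p h with path⇒run p
... | _ , r = _ , path-≤ p , (_ , _ , here refl , r) , h

⟨⟩-elim : ∀ {n} {δ : Transition n} {qf α k φ} → α , k ⊨ (⟨ automaton δ qf ⟩ φ) →
          Σ ℕ λ l → Accepts δ qf α k l × α , l ⊨ φ
⟨⟩-elim (l , _ , (_ , _ , here refl , r) , h) = l , run⇒path r , h

[]-intro : ∀ {n} {δ : Transition n} {qf α k φ} → (∀ l → Accepts δ qf α k l → α , l ⊨ φ) →
           α , k ⊨ ([ automaton δ qf ] φ)
[]-intro h l _ (_ , _ , here refl , r) = h l (run⇒path r)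

[]-elim : ∀ {n} {δ : Transition n} {qf α k l φ} → α , k ⊨ ([ automaton δ qf ] φ) →
          Accepts δ qf α k l → α , l ⊨ φ
[]-elim h p with path⇒run p
... | _ , r = h _ (path-≤ p) (_ , _ , here refl , r)

-- Truth constants, finite conjunctions and disjunctions.

noRun : ∀ {n} → PDA n
noRun = pda 0 0 [] [] []

-- An automaton without final states accepts nothing, which makes its box vacuously true and its
-- diamond false.
⊤f ⊥f : ∀ {n} → Formula (suc n)
⊤f = [ noRun ] atom fzero
⊥f = ⟨ noRun ⟩ atom fzero

⊤f-true : ∀ {n} {α : Word (suc n)} {k} → α , k ⊨ ⊤f
⊤f-true _ _ (_ , _ , () , _)

⊥f-false : ∀ {n} {α : Word (suc n)} {k} → ¬ (α , k ⊨ ⊥f)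
⊥f-false (_ , _ , (_ , _ , () , _) , _)

⋀ ⋁ : ∀ {n} {A : Set} → (A → Formula (suc n)) → List A → Formula (suc n)
⋀ F []       = ⊤f
⋀ F (x ∷ xs) = F x ∧f ⋀ F xs
⋁ F []       = ⊥f
⋁ F (x ∷ xs) = F x ∨f ⋁ F xs

module _ {n} {A : Set} {F : A → Formula (suc n)} {α : Word (suc n)} {k : ℕ} {P : A → Set} where

  ⋀-intro : (∀ {x} → P x → α , k ⊨ F x) → ∀ {xs} → All P xs → α , k ⊨ ⋀ F xs
  ⋀-intro h []       = ⊤f-true
  ⋀-intro h (p ∷ ps) = h p , ⋀-intro h ps

  ⋀-elim : (∀ {x} → α , k ⊨ F x → P x) → ∀ xs → α , k ⊨ ⋀ F xs → All P xs
  ⋀-elim h []       _        = []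
  ⋀-elim h (x ∷ xs) (p , ps) = h p ∷ ⋀-elim h xs ps

  ⋁-intro : (∀ {x} → P x → α , k ⊨ F x) → ∀ {xs} → Any P xs → α , k ⊨ ⋁ F xs
  ⋁-intro h (here p)  = inj₁ (h p)
  ⋁-intro h (there p) = inj₂ (⋁-intro h p)

  ⋁-elim : (∀ {x} → α , k ⊨ F x → P x) → ∀ xs → α , k ⊨ ⋁ F xs → Any P xs
  ⋁-elim h []       p        = ⊥-elim (⊥f-false p)
  ⋁-elim h (x ∷ xs) (inj₁ p) = here (h p)
  ⋁-elim h (x ∷ xs) (inj₂ p) = there (⋁-elim h xs p)

automaton-wf : ∀ {n} (δ : Transition n) qf → WFA (automaton δ qf)
automaton-wf δ qf = rulesOf-deterministic δ , tt

noRun-wf : ∀ {n} → WFA (noRun {n})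
noRun-wf = (λ _ _ ()) , tt

⋀-wf : ∀ {n} {A : Set} {F : A → Formula (suc n)} → (∀ x → WF (F x)) → ∀ xs → WF (⋀ F xs)
⋀-wf h []       = noRun-wf , tt
⋀-wf h (x ∷ xs) = h x , ⋀-wf h xs

⋁-wf : ∀ {n} {A : Set} {F : A → Formula (suc n)} → (∀ x → WF (F x)) → ∀ xs → WF (⋁ F xs)
⋁-wf h []       = noRun-wf , tt
⋁-wf h (x ∷ xs) = h x , ⋁-wf h xs

-- Letters, blocks and the comparison automaton.

-- Bit 0 marks the start of a block.  Bit suc i means label i on a marked letter and
-- register i on an unmarked one; a register's value is the number of its letters in the block.
bit : ∀ {n} → ℕ → Letter n → Bool
bit _       []      = false
bit zero    (b ∷ _) = b
bit (suc i) (_ ∷ a) = bit i a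

mark : ∀ {n} → Letter n → Bool
mark = bit 0

register : ∀ {n} → ℕ → Letter n → Bool
register i = bit (suc i)

labelled : ∀ {n} → ℕ → Letter n → Bool
labelled g a = mark a ∧ bit (suc g) a

source : ∀ {n} → Maybe ℕ → Letter n → Bool
source nothing  _ = false
source (just i) a = register i a

-- cmp s o g d compares the current block with the next block labelled g: register s
-- of the former (0 if s is nothing) plus the constant o equals register d of the latter.
data Cmp : Set where
  cmp : Maybe ℕ → ℕ → ℕ → ℕ → Cmp

-- A single move pushes all of `o`, so a constant of any size leaves the number of states at five.
-- The mark that ends the current block may already carry the label sought; then the searching state
-- 1 is skipped.
own : Bool → Bool → Bool → ℕ → ℕ → ℕ × List ℕ
own true  true  _     o X = 2 , replicate o 1 ++ X ∷ []
own true  false _     o X = 1 , replicate o 1 ++ X ∷ []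
own false _     true  _ X = 0 , 1 ∷ X ∷ []
own false _     false _ X = 0 , X ∷ []

search : Bool → ℕ → ℕ × List ℕ
search true  X = 2 , X ∷ []
search false X = 1 , X ∷ []

-- Equality means that the bottom symbol 0 is on top exactly when the block ends. A surplus tick
-- meets the bottom, a deficit leaves a 1 at the mark, and both lead to state 4, which is never
-- left.
other : Bool → Bool → ℕ → ℕ × List ℕ
other true  _     zero    = 3 , 0 ∷ []
other true  _     (suc X) = 4 , suc X ∷ []
other false true  zero    = 4 , 0 ∷ []
other false true  (suc X) = 2 , []
other false false X       = 2 , X ∷ []

cmpδ : ∀ {n} → Cmp → Transition n
cmpδ (cmp s o g d) 0 a X = own (mark a) (labelled g a) (source s a) o X
cmpδ (cmp s o g d) 1 a X = search (labelled g a) X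
cmpδ (cmp s o g d) 2 a X = other (mark a) (register d a) X
cmpδ _             _ a X = 4 , X ∷ []

-- Count α p k l m: the first marked position from k on is l, and m letters before it satisfy p.
data Count {n} (α : Word n) (p : Letter n → Bool) : ℕ → ℕ → ℕ → Set where
  end  : ∀ {k} → mark (α k) ≡ true → Count α p k k 0
  skip : ∀ {k l m} → mark (α k) ≡ false → p (α k) ≡ false → Count α p (suc k) l m → Count α p k l m
  hit  : ∀ {k l m} → mark (α k) ≡ false → p (α k) ≡ true → Count α p (suc k) l m → Count α p k l (suc m)

-- Seek α g k j: the first position labelled g from k on is j - 1.
data Seek {n} (α : Word n) (g : ℕ) : ℕ → ℕ → Set where
  found : ∀ {k} → labelled g (α k) ≡ true → Seek α g k (suc k)
  next  : ∀ {k j} → labelled g (α k) ≡ false → Seek α g (suc k) j → Seek α g k j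

Reg : ∀ {n} → Word n → (Letter n → Bool) → ℕ → ℕ → Set
Reg α p k m = Σ ℕ λ l → Count α p k l m

data Holds {n} (α : Word n) (k : ℕ) : Cmp → Set where
  holds : ∀ {s o g d m l j} → Count α (source s) k l m → Seek α g l j → Reg α (register d) j (o + m) →
          Holds α k (cmp s o g d)

true≢false : true ≢ false
true≢false ()

labelled-of-mark : ∀ {n} {g b} (a : Letter n) → mark a ≡ true → bit (suc g) a ≡ b → labelled g a ≡ b
labelled-of-mark _ e e' rewrite e = e'

count-unique : ∀ {n} {α : Word n} {p k l l' m m'} → Count α p k l m → Count α p k l' m' → m ≡ m'
count-unique (end _)      (end _)       = refl
count-unique (end e)      (skip e' _ _) = contradiction (trans (sym e) e') true≢false
count-unique (end e)      (hit e' _ _)  = contradiction (trans (sym e) e') true≢false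
count-unique (skip e _ _) (end e')      = contradiction (trans (sym e') e) true≢false
count-unique (skip _ _ c) (skip _ _ c') = count-unique c c'
count-unique (skip _ e _) (hit _ e' _)  = contradiction (trans (sym e') e) true≢false
count-unique (hit e _ _)  (end e')      = contradiction (trans (sym e') e) true≢false
count-unique (hit _ e _)  (skip _ e' _) = contradiction (trans (sym e) e') true≢false
count-unique (hit _ _ c)  (hit _ _ c')  = cong suc (count-unique c c')

-- Where a block ends does not depend on the register counted; dropping the register makes the ends
-- of different counts comparable.
forget : ∀ {n} {α : Word n} {p k l m} → Count α p k l m → Count α (source nothing) k l 0
forget (end e)      = end e
forget (skip e _ c) = skip e refl (forget c)
forget (hit e _ c)  = skip e refl (forget c)

end-unique : ∀ {n} {α : Word n} {k l l'} → Count α (source nothing) k l 0 → Count α (source nothing) k l' 0 → l ≡ l'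
end-unique (end _)      (end _)       = refl
end-unique (end e)      (skip e' _ _) = contradiction (trans (sym e) e') true≢false
end-unique (skip e _ _) (end e')      = contradiction (trans (sym e') e) true≢false
end-unique (skip _ _ c) (skip _ _ c') = end-unique c c'

seek-unique : ∀ {n} {α : Word n} {g k j j'} → Seek α g k j → Seek α g k j' → j ≡ j'
seek-unique (found _)  (found _)   = refl
seek-unique (found e)  (next e' _) = contradiction (trans (sym e) e') true≢false
seek-unique (next e _) (found e')  = contradiction (trans (sym e') e) true≢false
seek-unique (next _ s) (next _ s') = seek-unique s s'

-- Correctness of the comparison automaton.

-- The stack holding m, split into its top and the rest.
top : ℕ → ℕ
top zero    = 0
top (suc _) = 1

stack rest : ℕ → List ℕ
stack m = top m ∷ rest m
rest zero    = []
rest (suc m) = stack m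

top<2 : ∀ m → top m < 2
top<2 zero    = s≤s z≤n
top<2 (suc _) = s≤s (s≤s z≤n)

push-stack : ∀ o m → (replicate o 1 ++ top m ∷ []) ++ rest m ≡ stack (o + m)
push-stack zero    m = refl
push-stack (suc o) m = cong (1 ∷_) (push-stack o m)

private
  0<5 : 0 < 5
  0<5 = s≤s z≤n
  1<5 : 1 < 5
  1<5 = s≤s (s≤s z≤n)
  2<5 : 2 < 5
  2<5 = s≤s (s≤s (s≤s z≤n))

module _ {n} {α : Word n} {s : Maybe ℕ} {o g d : ℕ} where

  private
    P : ℕ → List ℕ → ℕ → ℕ → Set
    P = Path (cmpδ (cmp s o g d)) α 3

  dead : ∀ {s k l} → ¬ P 4 s k l
  dead (move _ _ p) = dead p

  other-sound : ∀ m {k l} → P 2 (stack m) k l → Reg α (register d) k m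
  other-sound zero {k} (move _ _ p) with mark (α k) in em | register d (α k) in er
  ... | true  | _     = _ , end em
  ... | false | true  = ⊥-elim (dead p)
  ... | false | false = _ , skip em er (proj₂ (other-sound zero p))
  other-sound (suc m) {k} (move _ _ p) with mark (α k) in em | register d (α k) in er
  ... | true  | _     = ⊥-elim (dead p)
  ... | false | true  = _ , hit em er (proj₂ (other-sound m p))
  ... | false | false = _ , skip em er (proj₂ (other-sound (suc m) p))

  other-complete : ∀ {k l m} → Count α (register d) k l m → P 2 (stack m) k (suc l)
  other-complete {k} (end e) = moveTo 2<5 (top<2 0) eq stop
    where eq : other (mark (α k)) (register d (α k)) 0 ≡ (3 , 0 ∷ [])
          eq rewrite e = refl
  other-complete {k} {m = m} (skip e e' c) = moveTo 2<5 (top<2 m) eq (other-complete c)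
    where eq : other (mark (α k)) (register d (α k)) (top m) ≡ (2 , top m ∷ [])
          eq rewrite e | e' = refl
  other-complete {k} {m = suc m} (hit e e' c) = moveTo 2<5 (top<2 (suc m)) eq (other-complete c)
    where eq : other (mark (α k)) (register d (α k)) 1 ≡ (2 , [])
          eq rewrite e | e' = refl

  search-sound : ∀ m {k l} → P 1 (stack m) k l → Σ ℕ λ j → Seek α g k j × Reg α (register d) j m
  search-sound m {k} (move _ _ p) with labelled g (α k) in e
  ... | true  = _ , found e , other-sound m p
  ... | false with search-sound m p
  ...   | j , s , r = j , next e s , r

  search-complete : ∀ m {k l j} → Seek α g k j → P 2 (stack m) j l → P 1 (stack m) k l
  search-complete m {k} (found e) p = moveTo 1<5 (top<2 m) (cong (λ b → search b (top m)) e) p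
  search-complete m (next e s) p = moveTo 1<5 (top<2 m) (cong (λ b → search b (top m)) e) (search-complete m s p)

  -- The induction needs the `m` symbols already pushed as an accumulator; a run from the initial
  -- stack has `m = 0`.
  own-sound : ∀ m {k l} → P 0 (stack m) k l →
              Σ ℕ λ c → Σ ℕ λ l' → Σ ℕ λ j →
                Count α (source s) k l' c × Seek α g l' j × Reg α (register d) j (o + (c + m))
  own-sound m {k} (move _ _ p) with mark (α k) in em | labelled g (α k) in el | source s (α k) in es
  ... | true | true | _ rewrite push-stack o m =
    0 , k , suc k , end em , found (labelled-of-mark (α k) em el) , other-sound (o + m) p
  ... | true | false | _ rewrite push-stack o m with search-sound (o + m) p
  ...   | j , sk , r = 0 , k , j , end em , next (labelled-of-mark (α k) em el) sk , r
  own-sound m {k} (move _ _ p) | false | _ | true with own-sound (suc m) p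
  ... | c , l , j , cnt , sk , r =
    suc c , l , j , hit em es cnt , sk , subst (λ x → Reg α (register d) j (o + x)) (+-suc c m) r
  own-sound m {k} (move _ _ p) | false | _ | false with own-sound m p
  ... | c , l , j , cnt , sk , r = c , l , j , skip em es cnt , sk , r

  own-complete : ∀ m {c k l l' j} → Count α (source s) k l' c → Seek α g l' j →
                 P 2 (stack (o + (c + m))) j l → P 0 (stack m) k l
  own-complete m {k = k} {l} (end e) (found el) p =
    moveTo 0<5 (top<2 m) eq (subst (λ st → P 2 st (suc k) l) (sym (push-stack o m)) p)
    where eq : own (mark (α k)) (labelled g (α k)) (source s (α k)) o (top m) ≡ (2 , replicate o 1 ++ top m ∷ [])
          eq rewrite e | el = refl
  own-complete m {k = k} {l} (end e) (next el sk) p =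
    moveTo 0<5 (top<2 m) eq (subst (λ st → P 1 st (suc k) l) (sym (push-stack o m)) (search-complete (o + m) sk p))
    where eq : own (mark (α k)) (labelled g (α k)) (source s (α k)) o (top m) ≡ (1 , replicate o 1 ++ top m ∷ [])
          eq rewrite e | el = refl
  own-complete m {k = k} (skip e es c) sk p = moveTo 0<5 (top<2 m) eq (own-complete m c sk p)
    where eq : own (mark (α k)) (labelled g (α k)) (source s (α k)) o (top m) ≡ (0 , top m ∷ [])
          eq rewrite e | es = refl
  own-complete m {suc c'} {k} {l} {j = j} (hit e es c) sk p =
    moveTo 0<5 (top<2 m) eq
      (own-complete (suc m) c sk (subst (λ x → P 2 (stack (o + x)) j l) (sym (+-suc c' m)) p))
    where eq : own (mark (α k)) (labelled g (α k)) (source s (α k)) o (top m) ≡ (0 , 1 ∷ top m ∷ [])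
          eq rewrite e | es = refl

cmpF : ∀ {n} → Cmp → Formula (suc n)
cmpF c = ⟨ automaton (cmpδ c) 3 ⟩ ⊤f

cmpF-elim : ∀ {n} {α : Word (suc n)} {k} c → α , k ⊨ cmpF c → Holds α k c
cmpF-elim {α = α} (cmp s o g d) h with ⟨⟩-elim {δ = cmpδ (cmp s o g d)} {φ = ⊤f} h
... | _ , p , _ with own-sound 0 p
... | c , l , j , cnt , sk , r = holds cnt sk (subst (λ x → Reg α (register d) j (o + x)) (+-identityʳ c) r)

cmpF-intro : ∀ {n} {α : Word (suc n)} {k} c → Holds α k c → α , k ⊨ cmpF c
cmpF-intro {α = α} (cmp s o g d) (holds {m = c} {j = j} cnt sk (_ , r)) =
  ⟨⟩-intro {δ = cmpδ (cmp s o g d)} {φ = ⊤f}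
    (own-complete 0 cnt sk
      (other-complete (subst (λ x → Count α (register d) j _ (o + x)) (sym (+-identityʳ c)) r)))
    ⊤f-true

-- Conditions on all blocks with a given label.

At : ∀ {n} → Word n → ℕ → ℕ → Set
At α g k = Σ ℕ λ i → k ≡ suc i × labelled g (α i) ≡ true

seek-at : ∀ {n} {α : Word n} {g k j} → Seek α g k j → At α g j
seek-at (found e)  = _ , refl , e
seek-at (next _ s) = seek-at s

afterState : Bool → ℕ
afterState true  = 1
afterState false = 0

-- Accepts the infixes whose last letter is labelled g.
afterδ : ∀ {n} → ℕ → Transition n
afterδ g _ a X = afterState (labelled g a) , X ∷ []

-- State 1 means that the letter just read is labelled `g`; the hypothesis carries this invariant
-- along the run and is vacuous in the initial state 0.
after-sound : ∀ {n} {α : Word n} {g q s k l} → (q ≡ 1 → At α g k) → Path (afterδ g) α 1 q s k l → At α g l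
after-sound h stop = h refl
after-sound {α = α} {g} {k = k} h (move _ _ p) = after-sound last p
  where
  last : afterState (labelled g (α k)) ≡ 1 → At α g (suc k)
  last e with labelled g (α k) in el
  ... | true = k , refl , el

after-complete : ∀ {n} {α : Word n} {g q} i k → q < 5 → labelled g (α (i + k)) ≡ true →
                 Path (afterδ g) α 1 q (0 ∷ []) k (suc (i + k))
after-complete zero    k q<5 e = moveTo q<5 (s≤s z≤n) (cong (λ b → afterState b , 0 ∷ []) e) stop
after-complete {α = α} {g} (suc i) k q<5 e =
  move q<5 (s≤s z≤n)
    (subst (Path (afterδ g) α 1 _ (0 ∷ []) (suc k)) (cong suc (+-suc i k))
      (after-complete i (suc k) (afterState<5 (labelled g (α k)))
        (subst (λ x → labelled g (α x) ≡ true) (sym (+-suc i k)) e)))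
  where
  afterState<5 : ∀ b → afterState b < 5
  afterState<5 true  = 1<5
  afterState<5 false = 0<5

-- Read at position 0, the box places `φ` just after the mark of every block labelled `g`.
afterF : ∀ {n} → ℕ → Formula n → Formula n
afterF g φ = [ automaton (afterδ g) 1 ] φ

afterF-elim : ∀ {n} {α : Word n} {g φ k} → α , 0 ⊨ afterF g φ → At α g k → α , k ⊨ φ
afterF-elim {α = α} {g} {φ} h (i , refl , e) =
  []-elim {δ = afterδ g} {φ = φ} h
    (subst (Accepts (afterδ g) 1 α 0) (cong suc (+-identityʳ i))
      (after-complete i 0 0<5 (subst (λ x → labelled g (α x) ≡ true) (sym (+-identityʳ i)) e)))

afterF-intro : ∀ {n} {α : Word n} {g φ} → (∀ k → At α g k → α , k ⊨ φ) → α , 0 ⊨ afterF g φ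
afterF-intro {g = g} {φ} h = []-intro {δ = afterδ g} {φ = φ} λ l p → h l (after-sound (λ ()) p)

-- Conditions are in disjunctive normal form.
Check : Set
Check = ℕ × List (List Cmp)

checkF : ∀ {n} → Check → Formula (suc n)
checkF (g , alts) = afterF g (⋁ (⋀ cmpF) alts)

Checked : ∀ {n} → Word n → Check → Set
Checked α (g , alts) = ∀ k → At α g k → Any (All (Holds α k)) alts

checkF-elim : ∀ {n} {α : Word (suc n)} c → α , 0 ⊨ checkF c → Checked α c
checkF-elim (g , alts) h k at =
  ⋁-elim (⋀-elim (λ {c} → cmpF-elim c) _) alts (afterF-elim {φ = ⋁ (⋀ cmpF) alts} h at)

checkF-intro : ∀ {n} {α : Word (suc n)} c → Checked α c → α , 0 ⊨ checkF c
checkF-intro (g , alts) h =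
  afterF-intro {φ = ⋁ (⋀ cmpF) alts} λ k at → ⋁-intro (⋀-intro (λ {c} → cmpF-intro c)) (h k at)

cmpF-wf : ∀ {n} c → WF (cmpF {n} c)
cmpF-wf c = automaton-wf (cmpδ c) 3 , noRun-wf , tt

checkF-wf : ∀ {n} c → WF (checkF {n} c)
checkF-wf (g , alts) = automaton-wf (afterδ g) 1 , ⋁-wf (⋀-wf cmpF-wf) alts

-- Finite lists of blocks and the words that spell them.

-- A block is its label with the list of its unmarked letters, given by their registers.
Block : Set
Block = ℕ × List ℕ

count : ℕ → List ℕ → ℕ
count i []       = 0
count i (t ∷ ts) = if i ≡ᵇ t then suc (count i ts) else count i ts

sourceCount : Maybe ℕ → List ℕ → ℕ
sourceCount nothing  _  = 0
sourceCount (just i) ts = count i ts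

data Next (g : ℕ) : List Block → List ℕ → Set where
  here  : ∀ {ts bs} → Next g ((g , ts) ∷ bs) ts
  there : ∀ {h us ts bs} → h ≢ g → Next g bs ts → Next g ((h , us) ∷ bs) ts

HoldsB : List ℕ → List Block → Cmp → Set
HoldsB ts bs (cmp s o g d) = Σ (List ℕ) λ us → Next g bs us × count d us ≡ o + sourceCount s ts

CheckedB : List Block → Check → Set
CheckedB []               _          = ⊤
CheckedB ((h , ts) ∷ bs) (g , alts) = (h ≡ g → Any (All (HoldsB ts bs)) alts) × CheckedB bs (g , alts)

markLetter tickLetter : ∀ {n} → ℕ → Letter (suc n)
markLetter g = true ∷ Vec.tabulate (λ i → toℕ i ≡ᵇ g)
tickLetter t = false ∷ Vec.tabulate (λ i → toℕ i ≡ᵇ t)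

bit-tabulate : ∀ {n} (h : ℕ → Bool) {i} → i < n → bit i (Vec.tabulate {n = n} (λ j → h (toℕ j))) ≡ h i
bit-tabulate {suc n} h {zero}  _         = refl
bit-tabulate {suc n} h {suc i} (s≤s i<n) = bit-tabulate (h ∘ suc) i<n

letters : ∀ {n} → List ℕ → List Block → List (Letter (suc n))
letters (t ∷ ts) bs              = tickLetter t ∷ letters ts bs
letters []       []              = []
letters []       ((g , ts) ∷ bs) = markLetter g ∷ letters ts bs

-- Past the end of the list the word is filled with letters labelled 0.
wordOf : ∀ {n} → List (Letter (suc n)) → Word (suc n)
wordOf []       _       = markLetter 0
wordOf (a ∷ as) zero    = a
wordOf (a ∷ as) (suc i) = wordOf as i

record Reads {n} (α : Word (suc n)) (k : ℕ) (ts : List ℕ) (bs : List Block) : Set where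
  constructor reads
  field letterAt : ∀ i → α (i + k) ≡ wordOf (letters ts bs) i

open Reads

module _ {n} {α : Word (suc n)} where

  reads-tick : ∀ {k t ts bs} → Reads α k (t ∷ ts) bs → Reads α (suc k) ts bs
  reads-tick {k} r = reads λ i → trans (cong α (+-suc i k)) (letterAt r (suc i))

  reads-mark : ∀ {k g ts bs} → Reads α k [] ((g , ts) ∷ bs) → Reads α (suc k) ts bs
  reads-mark {k} r = reads λ i → trans (cong α (+-suc i k)) (letterAt r (suc i))

  reads-end : ∀ {k} → Reads α k [] [] → Reads α (suc k) [] []
  reads-end {k} r = reads λ i → trans (cong α (+-suc i k)) (letterAt r (suc i))

  marked : ∀ {k} bs → Reads α k [] bs → mark (α k) ≡ true
  marked []      r rewrite letterAt r 0 = refl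
  marked (_ ∷ _) r rewrite letterAt r 0 = refl

  count-complete : ∀ {k i} ts {bs} → i < n → Reads α k ts bs →
                   Σ ℕ λ l → Count α (register i) k l (count i ts) × Reads α l [] bs
  count-complete {k} []       {bs} i<n r = k , end (marked bs r) , r
  count-complete {k} {i} (t ∷ ts) i<n r
    with i ≡ᵇ t in e | count-complete ts i<n (reads-tick r)
  ... | true  | l , c , r' = l , hit (cong mark (letterAt r 0)) (trans (cong (register i) (letterAt r 0)) (trans (bit-tabulate (_≡ᵇ t) i<n) e)) c , r'
  ... | false | l , c , r' = l , skip (cong mark (letterAt r 0)) (trans (cong (register i) (letterAt r 0)) (trans (bit-tabulate (_≡ᵇ t) i<n) e)) c , r'

  end-complete : ∀ {k} ts {bs} → Reads α k ts bs →
                 Σ ℕ λ l → Count α (source nothing) k l 0 × Reads α l [] bs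
  end-complete {k} []       {bs} r = k , end (marked bs r) , r
  end-complete {k} (t ∷ ts) r with end-complete ts (reads-tick r)
  ... | l , c , r' = l , skip (cong mark (letterAt r 0)) refl c , r'

  seek-complete : ∀ {k g us} ts bs → g < n → Reads α k ts bs → Next g bs us →
                  Σ ℕ λ j → Σ (List Block) λ cs → Seek α g k j × Reads α j us cs
  seek-complete {g = g} (t ∷ ts) bs g<n r x with seek-complete ts bs g<n (reads-tick r) x
  ... | j , cs , s , r' = j , cs , next (cong (labelled g) (letterAt r 0)) s , r'
  seek-complete {k} {g} [] ((.g , us) ∷ bs) g<n r here =
    suc k , bs , found (trans (cong (labelled g) (letterAt r 0)) (trans (bit-tabulate (_≡ᵇ g) g<n) (n≡ᵇn g))) , reads-mark r
    where
    n≡ᵇn : ∀ i → (i ≡ᵇ i) ≡ true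
    n≡ᵇn zero    = refl
    n≡ᵇn (suc i) = n≡ᵇn i
  seek-complete {g = g} [] ((h , us) ∷ bs) g<n r (there h≢g x) with seek-complete us bs g<n (reads-mark r) x
  ... | j , cs , s , r' =
    j , cs , next (trans (cong (labelled g) (letterAt r 0)) (trans (bit-tabulate (_≡ᵇ h) g<n) (≢⇒≡ᵇ h≢g))) s , r'
    where
    ≢⇒≡ᵇ : h ≢ g → (g ≡ᵇ h) ≡ false
    ≢⇒≡ᵇ ne with g ≡ᵇ h in e
    ... | true  = contradiction (sym (≡ᵇ⇒≡ g h (subst T (sym e) tt))) ne
    ... | false = refl

sourceIndex : Maybe ℕ → ℕ
sourceIndex nothing  = 0
sourceIndex (just i) = i

-- Each label and register index needs a bit of the letter, so it must lie below the width. The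
-- offset needs none and is left out, which keeps the width independent of the constants in the
-- template.
cmpSize : Cmp → ℕ
cmpSize (cmp s _ g d) = suc (sourceIndex s + (g + d))

checkSize : Check → ℕ
checkSize (g , alts) = suc g + sum (map (sum ∘ map cmpSize) alts)

sum-bounds : ∀ {A : Set} (f : A → ℕ) {n} xs → sum (map f xs) ≤ n → All (λ x → f x ≤ n) xs
sum-bounds f []       _ = []
sum-bounds f (x ∷ xs) h = m+n≤o⇒m≤o (f x) h ∷ sum-bounds f xs (m+n≤o⇒n≤o (f x) h)

module _ {n} {α : Word (suc n)} where

  holds-complete : ∀ {k ts bs} c → cmpSize c ≤ n → Reads α k ts bs → HoldsB ts bs c → Holds α k c
  holds-complete {k} {ts} {bs} (cmp s o g d) size≤n r (us , x , e) = go s size≤n e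
    where
    go : ∀ s → cmpSize (cmp s o g d) ≤ n → count d us ≡ o + sourceCount s ts → Holds α k (cmp s o g d)
    go s b e = holds (proj₁ (proj₂ src)) (proj₁ (proj₂ (proj₂ sk)))
                     (subst (Reg α (register d) (proj₁ sk)) e (_ , proj₁ (proj₂ dst)))
      where
      g+d<n : g + d < n
      g+d<n = ≤-trans (s≤s (m≤n+m (g + d) (sourceIndex s))) b
      ownBlock : ∀ s → sourceIndex s < n → Σ ℕ λ l → Count α (source s) k l (sourceCount s ts) × Reads α l [] bs
      ownBlock nothing  _   = end-complete ts r
      ownBlock (just i) i<n = count-complete ts i<n r
      src = ownBlock s (≤-trans (s≤s (m≤m+n (sourceIndex s) (g + d))) b)
      sk  = seek-complete [] bs (≤-trans (s≤s (m≤m+n g d)) g+d<n) (proj₂ (proj₂ src)) x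
      dst = count-complete us (≤-trans (s≤s (m≤n+m d g)) g+d<n) (proj₂ (proj₂ (proj₂ sk)))

  any-holds-complete : ∀ {k ts bs} alts → sum (map (sum ∘ map cmpSize) alts) ≤ n → Reads α k ts bs →
                       Any (All (HoldsB ts bs)) alts → Any (All (Holds α k)) alts
  any-holds-complete (alt ∷ alts) b r (here p)  =
    here (All.zipWith (λ { {c} (b , h) → holds-complete c b r h })
           (sum-bounds cmpSize alt (m+n≤o⇒m≤o (sum (map cmpSize alt)) b) , p))
  any-holds-complete (alt ∷ alts) b r (there p) =
    there (any-holds-complete alts (m+n≤o⇒n≤o (sum (map cmpSize alt)) b) r p)

  -- The recursion is on the distance `i` rather than on the blocks, because the word goes on after
  -- the last of them.
  locate : ∀ i {g alts k ts bs} → 0 < g → g < n → Reads α k ts bs → CheckedB bs (g , alts) →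
           labelled g (α (i + k)) ≡ true →
           Σ (List ℕ) λ us → Σ (List Block) λ cs → Reads α (suc (i + k)) us cs × Any (All (HoldsB us cs)) alts
  locate zero {g} {ts = t ∷ ts} 0<g g<n r ch e =
    contradiction (trans (sym e) (cong (labelled g) (letterAt r 0))) true≢false
  -- Beyond the last block every letter is a mark labelled 0, which `0 < g` excludes.
  locate zero {g} {ts = []} {[]} 0<g g<n r ch e =
    contradiction 0<g (subst (λ x → ¬ (0 < x)) (sym g≡0) (λ ()))
    where
    g≡0 : g ≡ 0
    g≡0 = ≡ᵇ⇒≡ g 0 (subst T (trans (sym e) (trans (cong (labelled g) (letterAt r 0)) (bit-tabulate (_≡ᵇ 0) g<n))) tt)
  locate zero {g} {ts = []} {(h , us) ∷ bs} 0<g g<n r (ch , _) e =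
    us , bs , reads-mark r , ch (sym g≡h)
    where
    g≡h : g ≡ h
    g≡h = ≡ᵇ⇒≡ g h (subst T (trans (sym e) (trans (cong (labelled g) (letterAt r 0)) (bit-tabulate (_≡ᵇ h) g<n))) tt)
  locate (suc i) {g} {alts} {k} {ts} {bs} 0<g g<n r ch e =
    subst (λ x → Σ (List ℕ) λ us → Σ (List Block) λ cs → Reads α (suc x) us cs × Any (All (HoldsB us cs)) alts)
      (+-suc i k) (go ts bs r ch)
    where
    e' : labelled g (α (i + suc k)) ≡ true
    e' = trans (cong (labelled g ∘ α) (+-suc i k)) e
    go : ∀ ts bs → Reads α k ts bs → CheckedB bs (g , alts) →
         Σ (List ℕ) λ us → Σ (List Block) λ cs → Reads α (suc (i + suc k)) us cs × Any (All (HoldsB us cs)) alts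
    go (t ∷ ts) bs             r ch       = locate i 0<g g<n (reads-tick r) ch e'
    go []       []             r ch       = locate i 0<g g<n (reads-end r) ch e'
    go []       ((h , us) ∷ bs) r (_ , ch) = locate i 0<g g<n (reads-mark r) ch e'

  checked-complete : ∀ {ts bs} c → 0 < proj₁ c → checkSize c ≤ n → Reads α 0 ts bs → CheckedB bs c → Checked α c
  checked-complete {ts} {bs} (g , alts) 0<g b r ch k (i , refl , e)
    with locate i 0<g (m+n≤o⇒m≤o (suc g) b) r ch (trans (cong (labelled g ∘ α) (+-identityʳ i)) e)
  ... | us , cs , r' , h =
    any-holds-complete alts (m+n≤o⇒n≤o (suc g) b) (subst (λ x → Reads α (suc x) us cs) (+-identityʳ i) r') h

-- The conditions attached to a code.

copies : ℕ → ℕ → ℕ → ℕ → List Cmp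
copies k a g d = tabulate {n = k} λ i → cmp (just (a + toℕ i)) 0 g (d + toℕ i)

-- The node at base b of a code uses the labels from b up to its limit.
mutual
  limit : ∀ {k} → Code k → ℕ → ℕ
  limit zer         b = 2 + b
  limit suc′        b = 2 + b
  limit (proj _)    b = 2 + b
  limit (comp f gs) b = limits gs (limit f (1 + b))
  limit (prec f g)  b = limit g (limit f (2 + b))
  limit (mu f)      b = limit f (3 + b)

  limits : ∀ {k m} → Vec (Code k) m → ℕ → ℕ
  limits []       b = b
  limits (g ∷ gs) b = limits gs (limit g b)

valueCmps : ∀ {k m} → Vec (Code k) m → ℕ → ℕ → List Cmp
valueCmps         []       a b = []
valueCmps {k = k} (g ∷ gs) a b = cmp (just a) 0 b 0 ∷ copies k 1 b 1 ++ valueCmps gs (suc a) (limit g b)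

-- A block labelled b claims that the code at base b evaluates on registers 1, …, k to
-- register 0; the registers from k + 1 on hold intermediate values.  A comparison between two
-- registers of the same block goes through an auxiliary block (labels 1 + b, and 2 + b for mu).
-- For mu f, a block labelled 1 + b claims that f is positive below register 1.
precCheck : ∀ {k} → Code k → ℕ → Check
precCheck {k} f b =
  b , (cmp (just 1) 0 (1 + b) 0 ∷ cmp nothing 0 (1 + b) 0 ∷
       cmp (just 0) 0 (2 + b) 0 ∷ copies k 2 (2 + b) 1)
    ∷ (cmp (just 1) 0 (1 + b) 0 ∷ cmp (just (2 + k)) 1 (1 + b) 0 ∷
       cmp (just (2 + k)) 0 (limit f (2 + b)) 1 ∷ cmp (just (3 + k)) 0 (limit f (2 + b)) 2 ∷
       cmp (just 0) 0 (limit f (2 + b)) 0 ∷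
       cmp (just (2 + k)) 0 b 1 ∷ cmp (just (3 + k)) 0 b 0 ∷
       copies k 2 (limit f (2 + b)) 3 ++ copies k 2 b 2)
    ∷ []

positiveBelowCheck : ℕ → ℕ → Check
positiveBelowCheck k b =
  1 + b , (cmp (just 1) 0 (2 + b) 0 ∷ cmp nothing 0 (2 + b) 0 ∷ [])
        ∷ (cmp (just 1) 0 (2 + b) 0 ∷ cmp (just (2 + k)) 1 (2 + b) 0 ∷
           cmp (just (2 + k)) 0 (3 + b) 1 ∷ cmp (just (3 + k)) 1 (3 + b) 0 ∷
           cmp (just (2 + k)) 0 (1 + b) 1 ∷
           copies k 2 (3 + b) 2 ++ copies k 2 (1 + b) 2)
        ∷ []

mutual
  checks : ∀ {k} → Code k → ℕ → List Check
  checks zer b =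
    (b , (cmp (just 0) 0 (1 + b) 0 ∷ cmp nothing 0 (1 + b) 0 ∷ []) ∷ []) ∷ []
  checks suc′ b =
    (b , (cmp (just 0) 0 (1 + b) 0 ∷ cmp (just 1) 1 (1 + b) 0 ∷ []) ∷ []) ∷ []
  checks (proj i) b =
    (b , (cmp (just 0) 0 (1 + b) 0 ∷ cmp (just (1 + toℕ i)) 0 (1 + b) 0 ∷ []) ∷ []) ∷ []
  checks {k} (comp {m = m} f gs) b =
    (b , (cmp (just 0) 0 (1 + b) 0 ∷ copies m (1 + k) (1 + b) 1
            ++ valueCmps gs (1 + k) (limit f (1 + b))) ∷ [])
    ∷ checks f (1 + b) ++ checksV gs (limit f (1 + b))
  checks (prec f g) b =
    precCheck f b
    ∷ checks f (2 + b) ++ checks g (limit f (2 + b))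
  -- The child at `3 + b` shows that `f` vanishes at the value; the child at `1 + b` shows that it
  -- is positive at every smaller argument.
  checks {k} (mu f) b =
    (b , (cmp (just 0) 0 (3 + b) 1 ∷ cmp nothing 0 (3 + b) 0 ∷ cmp (just 0) 0 (1 + b) 1 ∷
          copies k 1 (3 + b) 2 ++ copies k 1 (1 + b) 2) ∷ [])
    ∷ positiveBelowCheck k b
    ∷ checks f (3 + b)

  checksV : ∀ {k m} → Vec (Code k) m → ℕ → List Check
  checksV []       b = []
  checksV (g ∷ gs) b = checks g b ++ checksV gs (limit g b)

-- Soundness: checked words yield derivations.

reg-unique : ∀ {n} {α : Word n} {p k m m'} → Reg α p k m → Reg α p k m' → m ≡ m'
reg-unique {α = α} {p} {k} {m} (l , c) (l' , c')
  with end-unique (forget c) (forget c')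
... | refl = count-unique c c'

-- The count ignores all registers, so that comparisons with different sources name the same child.
Child : ∀ {n} → Word n → ℕ → ℕ → ℕ → Set
Child α k g j = Σ ℕ λ l → Count α (source nothing) k l 0 × Seek α g l j

child-unique : ∀ {n} {α : Word n} {k g j j'} → Child α k g j → Child α k g j' → j ≡ j'
child-unique (_ , c , s) (_ , c' , s') with end-unique c c'
... | refl = seek-unique s s'

record Registers {n m} (α : Word n) (k a : ℕ) (xs : Vec ℕ m) : Set where
  constructor registers
  field valueAt : ∀ i → Reg α (register (a + toℕ i)) k (lookup xs i)

open Registers

module _ {n} {α : Word n} where

  childOf : ∀ {k s o g d} → Holds α k (cmp s o g d) → Σ ℕ λ j → Child α k g j × At α g j
  childOf (holds {l = l} {j} c s _) = j , (l , forget c , s) , seek-at s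

  sourceOf : ∀ {k s o g d} → Holds α k (cmp s o g d) → Σ ℕ λ m → Reg α (source s) k m
  sourceOf (holds {m = m} {l} c _ _) = m , l , c

  transfer : ∀ {k s o g d m j} → Holds α k (cmp s o g d) → Reg α (source s) k m → Child α k g j →
             Reg α (register d) j (o + m)
  transfer (holds c s r') r ch with reg-unique r (_ , c) | child-unique ch (_ , forget c , s)
  ... | refl | refl = r'

  transfer-constant : ∀ {k o g d j} → Holds α k (cmp nothing o g d) → Child α k g j → Reg α (register d) j o
  transfer-constant {o = o} {d = d} {j} h ch@(l , c , _) =
    subst (Reg α (register d) j) (+-identityʳ o) (transfer h (l , c) ch)

  -- The child is a go-between: both sides equal its register `d`, whatever that contains.
  equate : ∀ {k s o s' o' g d m m'} → Holds α k (cmp s o g d) → Holds α k (cmp s' o' g d) →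
           Reg α (source s) k m → Reg α (source s') k m' → o + m ≡ o' + m'
  equate h h' r r' with childOf h
  ... | _ , ch , _ = reg-unique (transfer h r ch) (transfer h' r' ch)

  equate-constant : ∀ {k s o o' g d m} → Holds α k (cmp s o g d) → Holds α k (cmp nothing o' g d) →
                    Reg α (source s) k m → o + m ≡ o'
  equate-constant h h' r with childOf h
  ... | _ , ch , _ = reg-unique (transfer h r ch) (transfer-constant h' ch)

  transfer-copies : ∀ {k m a g d j} {xs : Vec ℕ m} → All (Holds α k) (copies m a g d) →
                    Child α k g j → Registers α k a xs → Registers α j d xs
  transfer-copies hs ch rs = registers λ i → transfer (Allₚ.tabulate⁻ hs i) (valueAt rs i) ch

  mutual
    sound : ∀ {k} (f : Code k) b → All (Checked α) (checks f b) → ∀ {pos xs v} →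
            At α b pos → Registers α pos 1 xs → Reg α (register 0) pos v → Eval f xs v
    sound zer b (c ∷ []) at xs v with c _ at
    ... | here (h ∷ h' ∷ []) rewrite equate-constant h h' v = ezer
    sound suc′ b (c ∷ []) {xs = x ∷ []} at xs v with c _ at
    ... | here (h ∷ h' ∷ []) rewrite equate h h' v (valueAt xs fzero) = esuc
    sound (proj i) b (c ∷ []) at xs v with c _ at
    ... | here (h ∷ h' ∷ []) rewrite equate h h' v (valueAt xs i) = eproj
    sound {k} (comp {m = m} f gs) b (c ∷ cs) at xs v with c _ at
    ... | here (h ∷ hs)
      with Allₚ.++⁻ (checks f (1 + b)) cs | Allₚ.++⁻ (copies m (1 + k) (1 + b) 1) hs
    ... | cf , cgs | hf , hgs with soundV gs (1 + k) (limit f (1 + b)) cgs hgs xs | childOf h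
    ... | ys , rys , egs | _ , ch , at' =
      ecomp egs (sound f (1 + b) cf at' (transfer-copies hf ch rys) (transfer h v ch))
    sound (prec f g) b (c ∷ cs) {xs = y ∷ xs} at rs v =
      soundPrec f g b c (Allₚ.++⁻ˡ (checks f (2 + b)) cs) (Allₚ.++⁻ʳ (checks f (2 + b)) cs)
                y at (valueAt rs fzero) (registers (valueAt rs ∘ fsuc)) v
    sound {k} (mu f) b (c ∷ c' ∷ cs) at xs v with c _ at
    ... | here (h₁ ∷ h₂ ∷ h₃ ∷ hs) with Allₚ.++⁻ (copies k 1 (3 + b) 2) hs | childOf h₁ | childOf h₃
    ... | hf , hm | _ , ch , at' | _ , chm , atm =
      emu (sound f (3 + b) cs at'
             (registers λ { fzero → transfer h₁ v ch ; (fsuc i) → valueAt (transfer-copies hf ch xs) i })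
             (transfer-constant h₂ ch))
          (soundPositiveBelow f b c' cs _ atm (transfer h₃ v chm) (transfer-copies hm chm xs))

    soundV : ∀ {k m} (gs : Vec (Code k) m) a b → All (Checked α) (checksV gs b) → ∀ {pos xs} →
             All (Holds α pos) (valueCmps gs a b) → Registers α pos 1 xs →
             Σ (Vec ℕ m) λ ys → Registers α pos a ys × EvalV gs xs ys
    soundV [] a b cs hs xs = [] , registers (λ ()) , []
    soundV {k} (g ∷ gs) a b cs {pos} (h ∷ hs) xs
      with Allₚ.++⁻ (checks g b) cs | Allₚ.++⁻ (copies k 1 b 1) hs
    ... | cg , cgs | hg , hgs with soundV gs (suc a) (limit g b) cgs hgs xs | childOf h | sourceOf h
    ... | ys , rys , egs | _ , ch , at | y , ry =
      y ∷ ys , registers rs , sound g b cg at (transfer-copies hg ch xs) (transfer h ry ch) ∷ egs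
      where
      rs : ∀ i → Reg α (register (a + toℕ i)) pos (lookup (y ∷ ys) i)
      rs fzero    = subst (λ i → Reg α (register i) pos y) (sym (+-identityʳ a)) ry
      rs (fsuc i) = subst (λ j → Reg α (register j) pos (lookup ys i)) (sym (+-suc a (toℕ i))) (valueAt rys i)

    -- A recursive call goes to a block with the same label and the same code, so the code does not
    -- shrink; the argument `y`, read off register 1, decreases instead.
    soundPrec : ∀ {k} (f : Code k) g b → Checked α (precCheck f b) →
                All (Checked α) (checks f (2 + b)) → All (Checked α) (checks g (limit f (2 + b))) →
                ∀ y {pos xs v} → At α b pos → Reg α (register 1) pos y → Registers α pos 2 xs →
                Reg α (register 0) pos v → Eval (prec f g) (y ∷ xs) v
    soundPrec {k} f g b c cf cg zero at ry xs v with c _ at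
    ... | here (_ ∷ _ ∷ h ∷ hs) with childOf h
    ...   | _ , ch , at' =
      eprec0 (sound f (2 + b) cf at' (transfer-copies hs ch xs) (transfer h v ch))
    soundPrec {k} f g b c cf cg zero at ry xs v | there (here (h₁ ∷ h₂ ∷ _)) =
      contradiction (equate h₁ h₂ ry (proj₂ (sourceOf h₂))) λ ()
    soundPrec {k} f g b c cf cg (suc y) at ry xs v with c _ at
    ... | here (h₁ ∷ h₂ ∷ _) = contradiction (equate-constant h₁ h₂ ry) λ ()
    -- `h₁` and `h₂` make register `2 + k` the predecessor of register 1. Register `3 + k` guesses
    -- the value of the recursive call: `h₄` hands it to `g` as an argument and `h₇` has it
    -- confirmed by the next block labelled `b`.
    ... | there (here (h₁ ∷ h₂ ∷ h₃ ∷ h₄ ∷ h₅ ∷ h₆ ∷ h₇ ∷ hs))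
      with sourceOf h₃ | sourceOf h₄ | childOf h₃ | childOf h₆
         | Allₚ.++⁻ (copies k 2 (limit f (2 + b)) 3) hs
    ... | y' , ry' | w , rw | _ , chg , atg | _ , chp , atp | hg , hp
      with equate h₁ h₂ ry ry'
    ... | refl =
      eprecS (soundPrec f g b c cf cg y atp (transfer h₆ ry' chp) (transfer-copies hp chp xs) (transfer h₇ rw chp))
             (sound g (limit f (2 + b)) cg atg
               (registers λ { fzero → transfer h₃ ry' chg ; (fsuc fzero) → transfer h₄ rw chg
                  ; (fsuc (fsuc i)) → valueAt (transfer-copies hg chg xs) i })
               (transfer h₅ v chg))

    -- Each link of the chain treats the argument just below its bound and hands that argument on as
    -- the new bound, so the recursion is on the bound.
    soundPositiveBelow : ∀ {k} (f : Code (suc k)) b → Checked α (positiveBelowCheck k b) → All (Checked α) (checks f (3 + b)) →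
              ∀ y {pos xs} → At α (1 + b) pos → Reg α (register 1) pos y → Registers α pos 2 xs →
              ∀ m → m < y → Σ ℕ λ v → Eval f (m ∷ xs) (suc v)
    soundPositiveBelow {k} f b c cf (suc y) at ry xs m m<y with c _ at
    ... | here (h₁ ∷ h₂ ∷ _) = contradiction (equate-constant h₁ h₂ ry) λ ()
    ... | there (here (h₁ ∷ h₂ ∷ h₃ ∷ h₄ ∷ h₅ ∷ hs))
      with sourceOf h₃ | sourceOf h₄ | childOf h₃ | childOf h₅ | Allₚ.++⁻ (copies k 2 (3 + b) 2) hs
    ... | y' , ry' | w , rw | _ , chf , atf | _ , chm , atm | hf , hm
      with equate h₁ h₂ ry ry' | m≤n⇒m<n∨m≡n (s≤s⁻¹ m<y)
    ... | refl | inj₁ m<y' =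
      soundPositiveBelow f b c cf y atm (transfer h₅ ry' chm) (transfer-copies hm chm xs) m m<y'
    -- The offset 1 in `h₄` makes the value of `f` equal to `suc w`: positivity is witnessed by the
    -- predecessor kept in register `3 + k`.
    ... | refl | inj₂ refl =
      w , sound f (3 + b) cf atf
            (registers λ { fzero → transfer h₃ ry' chf ; (fsuc i) → valueAt (transfer-copies hf chf xs) i })
            (transfer h₄ rw chf)

-- Label ranges and concatenation of checked lists.

Within : ℕ → ℕ → ℕ → Set
Within b e g = b ≤ g × g < e

widen : ∀ {b b' e e'} {A : Set} {xs : List (ℕ × A)} → b' ≤ b → e ≤ e' →
        All (Within b e ∘ proj₁) xs → All (Within b' e' ∘ proj₁) xs
widen b'≤b e≤e' = All.map λ { (p , q) → ≤-trans b'≤b p , ≤-trans q e≤e' }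

mutual
  limit-> : ∀ {k} (f : Code k) b → b < limit f b
  limit-> zer         b = n≤1+n _
  limit-> suc′        b = n≤1+n _
  limit-> (proj _)    b = n≤1+n _
  limit-> (comp f gs) b = ≤-trans (<⇒≤ (limit-> f (1 + b))) (limits-≥ gs (limit f (1 + b)))
  limit-> (prec f g)  b = ≤-trans (n≤1+n _) (≤-trans (<⇒≤ (limit-> f (2 + b))) (<⇒≤ (limit-> g (limit f (2 + b)))))
  limit-> (mu f)      b = ≤-trans (m≤n+m _ 2) (<⇒≤ (limit-> f (3 + b)))

  limits-≥ : ∀ {k m} (gs : Vec (Code k) m) b → b ≤ limits gs b
  limits-≥ []       b = ≤-refl
  limits-≥ (g ∷ gs) b = ≤-trans (<⇒≤ (limit-> g b)) (limits-≥ gs (limit g b))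

mutual
  checks-within : ∀ {k} (f : Code k) b → All (Within b (limit f b) ∘ proj₁) (checks f b)
  checks-within zer         b = (≤-refl , limit-> (zer {0}) b) ∷ []
  checks-within suc′        b = (≤-refl , limit-> suc′ b) ∷ []
  checks-within (proj i)    b = (≤-refl , limit-> (proj i) b) ∷ []
  checks-within (comp f gs) b =
    (≤-refl , limit-> (comp f gs) b)
    ∷ Allₚ.++⁺ (widen (n≤1+n b) (limits-≥ gs (limit f (1 + b))) (checks-within f (1 + b)))
               (widen (<⇒≤ (<-trans (n<1+n b) (limit-> f (1 + b)))) ≤-refl (checksV-within gs (limit f (1 + b))))
  checks-within (prec f g)  b =
    (≤-refl , limit-> (prec f g) b)
    ∷ Allₚ.++⁺ (widen (m≤n+m b 2) (<⇒≤ (limit-> g (limit f (2 + b)))) (checks-within f (2 + b)))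
               (widen (≤-trans (m≤n+m b 2) (<⇒≤ (limit-> f (2 + b)))) ≤-refl (checks-within g (limit f (2 + b))))
  checks-within (mu f)      b =
    (≤-refl , limit-> (mu f) b)
    ∷ (n≤1+n b , ≤-trans (n≤1+n _) (<⇒≤ (limit-> f (3 + b))))
    ∷ widen (m≤n+m b 3) ≤-refl (checks-within f (3 + b))

  checksV-within : ∀ {k m} (gs : Vec (Code k) m) b → All (Within b (limits gs b) ∘ proj₁) (checksV gs b)
  checksV-within []       b = []
  checksV-within (g ∷ gs) b =
    Allₚ.++⁺ (widen ≤-refl (limits-≥ gs (limit g b)) (checks-within g b))
             (widen (<⇒≤ (limit-> g b)) ≤-refl (checksV-within gs (limit g b)))

next-++ : ∀ {g bs us} cs → Next g bs us → Next g (bs ++ cs) us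
next-++ cs here        = here
next-++ cs (there n x) = there n (next-++ cs x)

next-skip : ∀ {g bs us cs} → All (λ c → proj₁ c ≢ g) cs → Next g bs us → Next g (cs ++ bs) us
next-skip []       x = x
next-skip (n ∷ ns) x = there n (next-skip ns x)

holdsB-++ : ∀ {ts bs} cs c → HoldsB ts bs c → HoldsB ts (bs ++ cs) c
holdsB-++ cs (cmp _ _ _ _) (us , x , e) = us , next-++ cs x , e

-- Comparisons look only forward and stop at the first hit, so blocks appended later cannot disturb
-- one that already succeeded.
checkedB-++ : ∀ {bs cs c} → CheckedB bs c → CheckedB cs c → CheckedB (bs ++ cs) c
checkedB-++ {[]}                    _        h' = h'
checkedB-++ {_ ∷ bs} {cs} {c} (h , hs) h' =
  (λ e → Any.map (All.map λ {c} → holdsB-++ cs c) (h e)) , checkedB-++ {bs} hs h'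

checkedB-other : ∀ {bs c} → All (λ b → proj₁ b ≢ proj₁ c) bs → CheckedB bs c
checkedB-other []       = tt
checkedB-other (n ∷ ns) = (λ e → contradiction e n) , checkedB-other ns

AllChecked : List Block → List Check → Set
AllChecked bs = All (CheckedB bs)

allChecked-++ : ∀ {bs bs' cs} → AllChecked bs cs → AllChecked bs' cs → AllChecked (bs ++ bs') cs
allChecked-++ {bs} h h' = All.zipWith (λ { (p , q) → checkedB-++ {bs} p q }) (h , h')

-- A condition constrains only blocks bearing its own label, so blocks outside the label range of a
-- code meet its conditions vacuously.
allChecked-below : ∀ {b e bs cs} → All (Within b e ∘ proj₁) cs → All (λ x → proj₁ x < b) bs → AllChecked bs cs
allChecked-below w below =
  All.map (λ { (b≤ , _) → checkedB-other (All.map (λ x<b e → <⇒≢ (≤-trans x<b b≤) e) below) }) w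

allChecked-above : ∀ {b e bs cs} → All (Within b e ∘ proj₁) cs → All (λ x → e ≤ proj₁ x) bs → AllChecked bs cs
allChecked-above w above =
  All.map (λ { (_ , <e) → checkedB-other (All.map (λ e≤x e → <⇒≢ (≤-trans <e e≤x) (sym e)) above) }) w

-- Blocks with prescribed register contents.

ticks : List ℕ → List ℕ
ticks []       = []
ticks (v ∷ vs) = replicate v 0 ++ map suc (ticks vs)

valueOf : List ℕ → ℕ → ℕ
valueOf []       _       = 0
valueOf (v ∷ _)  zero    = v
valueOf (_ ∷ vs) (suc i) = valueOf vs i

count-suc-0 : ∀ ts → count 0 (map suc ts) ≡ 0
count-suc-0 []       = refl
count-suc-0 (_ ∷ ts) = count-suc-0 ts

count-suc-suc : ∀ i ts → count (suc i) (map suc ts) ≡ count i ts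
count-suc-suc i []       = refl
count-suc-suc i (t ∷ ts) with i ≡ᵇ t
... | true  = cong suc (count-suc-suc i ts)
... | false = count-suc-suc i ts

count-ticks : ∀ i vs → count i (ticks vs) ≡ valueOf vs i
count-ticks i       []           = refl
count-ticks zero    (zero ∷ vs)  = count-suc-0 (ticks vs)
count-ticks zero    (suc v ∷ vs) = cong suc (count-ticks zero (v ∷ vs))
count-ticks (suc i) (zero ∷ vs)  = trans (count-suc-suc i (ticks vs)) (count-ticks i vs)
count-ticks (suc i) (suc v ∷ vs) = count-ticks (suc i) (v ∷ vs)

valueOf-toList : ∀ {k} (xs : Vec ℕ k) ys i → valueOf (toList xs ++ ys) (toℕ i) ≡ lookup xs i
valueOf-toList (x ∷ xs) ys fzero    = refl
valueOf-toList (x ∷ xs) ys (fsuc i) = valueOf-toList xs ys i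

valueOf-drop : ∀ {k} (xs : Vec ℕ k) ys j → valueOf (toList xs ++ ys) (j + k) ≡ valueOf ys j
valueOf-drop []       ys j = cong (valueOf ys) (+-identityʳ j)
valueOf-drop {suc k} (x ∷ xs) ys j =
  trans (cong (valueOf (x ∷ toList xs ++ ys)) (+-suc j k)) (valueOf-drop xs ys j)

record RegistersB {m} (ts : List ℕ) (a : ℕ) (xs : Vec ℕ m) : Set where
  constructor registersB
  field countAt : ∀ i → count (a + toℕ i) ts ≡ lookup xs i

open RegistersB

claim : ∀ {k} → ℕ → Vec ℕ k → List ℕ → List ℕ
claim v xs ys = ticks (v ∷ toList xs ++ ys)

claim-value : ∀ {k} v (xs : Vec ℕ k) ys → count 0 (claim v xs ys) ≡ v
claim-value v xs ys = count-ticks 0 (v ∷ toList xs ++ ys)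

claim-arguments : ∀ {k} v (xs : Vec ℕ k) ys → RegistersB (claim v xs ys) 1 xs
claim-arguments v xs ys = registersB λ i →
  trans (count-ticks (suc (toℕ i)) (v ∷ toList xs ++ ys)) (valueOf-toList xs ys i)

claim-extra : ∀ {k} v (xs : Vec ℕ k) ys j → count (suc (j + k)) (claim v xs ys) ≡ valueOf ys j
claim-extra {k} v xs ys j = trans (count-ticks (suc (j + k)) (v ∷ toList xs ++ ys)) (valueOf-drop xs ys j)

tail-registers : ∀ {m ts x} {xs : Vec ℕ m} → RegistersB ts 1 (x ∷ xs) → RegistersB ts 2 xs
tail-registers r = registersB (countAt r ∘ fsuc)

copies-hold : ∀ {m ts bs g us a d} {xs : Vec ℕ m} → Next g bs us → RegistersB ts a xs → RegistersB us d xs →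
              All (HoldsB ts bs) (copies m a g d)
copies-hold x r r' = Allₚ.tabulate⁺ λ i → _ , x , trans (countAt r' i) (sym (countAt r i))

target : Cmp → ℕ
target (cmp _ _ g _) = g

valueCmps-target : ∀ {k m} (gs : Vec (Code k) m) a b → All (λ c → b ≤ target c) (valueCmps gs a b)
valueCmps-target []       a b = []
valueCmps-target {k} (g ∷ gs) a b =
  ≤-refl ∷ Allₚ.++⁺ {xs = copies k 1 b 1} (Allₚ.tabulate⁺ λ _ → ≤-refl)
    (All.map (≤-trans (<⇒≤ (limit-> g b))) (valueCmps-target gs (suc a) (limit g b)))

holdsB-skip : ∀ {ts bs cs e} c → All (λ x → proj₁ x < e) cs → e ≤ target c → HoldsB ts bs c → HoldsB ts (cs ++ bs) c
holdsB-skip (cmp _ _ _ _) below e≤ (us , x , eq) =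
  us , next-skip (All.map (λ x<e → <⇒≢ (≤-trans x<e e≤)) below) x , eq

-- Completeness: derivations yield checked lists of blocks.

record Trace {k} (f : Code k) (b : ℕ) (xs : Vec ℕ k) (v : ℕ) : Set where
  constructor trace
  field
    {self}    : List ℕ
    {blocks}  : List Block
    value     : count 0 self ≡ v
    arguments : RegistersB self 1 xs
    within    : All (Within b (limit f b) ∘ proj₁) blocks
    checked   : AllChecked ((b , self) ∷ blocks) (checks f b)

-- The block that calls `gs` lies outside these blocks, hence the quantification over its contents
-- `ts` in `called`.
record TraceV {k m} (gs : Vec (Code k) m) (b : ℕ) (xs : Vec ℕ k) (ys : Vec ℕ m) : Set where
  constructor traceV
  field
    {blocks} : List Block
    within   : All (Within b (limits gs b) ∘ proj₁) blocks
    checked  : AllChecked blocks (checksV gs b)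
    called   : ∀ {ts a} → RegistersB ts 1 xs → RegistersB ts a ys → All (HoldsB ts blocks) (valueCmps gs a b)

record PositiveBelow {k} (f : Code (suc k)) (b : ℕ) (xs : Vec ℕ k) (m : ℕ) : Set where
  constructor positiveBelow
  field
    {self}    : List ℕ
    {blocks}  : List Block
    arguments : RegistersB self 1 (m ∷ xs)
    within    : All (Within b (limit (mu f) b) ∘ proj₁) blocks
    checked   : AllChecked ((1 + b , self) ∷ blocks) (checks (mu f) b)

auxiliary : ℕ → List ℕ
auxiliary m = ticks (m ∷ [])

count-auxiliary : ∀ m → count 0 (auxiliary m) ≡ m
count-auxiliary m = count-ticks 0 (m ∷ [])

with-self : ∀ {k b} {bs : List Block} {ts} (f : Code k) → All (Within b (limit f b) ∘ proj₁) bs →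
            All (Within b (limit f b) ∘ proj₁) ((b , ts) ∷ bs)
with-self {b = b} f w = (≤-refl , limit-> f b) ∷ w

above : ∀ {b e b'} {bs : List Block} → b' ≤ b → All (Within b e ∘ proj₁) bs → All (λ x → b' ≤ proj₁ x) bs
above b'≤b = All.map λ { (p , _) → ≤-trans b'≤b p }

below : ∀ {b e e'} {bs : List Block} → e ≤ e' → All (Within b e ∘ proj₁) bs → All (λ x → proj₁ x < e') bs
below e≤e' = All.map λ { (_ , q) → ≤-trans q e≤e' }

unequal : ∀ {b} {bs : List Block} → All (λ x → suc b ≤ proj₁ x) bs → All (λ x → proj₁ x ≢ b) bs
unequal = All.map >⇒≢

-- The three basic codes all assert one equation inside a block; a single auxiliary block holding
-- the common value `m` of both sides settles it.
leaf : ∀ {k} {f : Code k} {b m o o' s s'} {xs : Vec ℕ k} {v} →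
       checks f b ≡ (b , (cmp s o (1 + b) 0 ∷ cmp s' o' (1 + b) 0 ∷ []) ∷ []) ∷ [] → limit f b ≡ 2 + b →
       m ≡ o + sourceCount s (claim v xs []) → m ≡ o' + sourceCount s' (claim v xs []) → Trace f b xs v
leaf {f = f} {b} {m} {xs = xs} {v} ec el e e' =
  trace (claim-value v xs []) (claim-arguments v xs [])
    (subst (λ l → All (Within b l ∘ proj₁) blocks) (sym el) ((n≤1+n b , ≤-refl) ∷ []))
    (subst (AllChecked ((b , claim v xs []) ∷ blocks)) (sym ec)
      (((λ _ → here ((_ , here , trans (count-auxiliary m) e) ∷ (_ , here , trans (count-auxiliary m) e') ∷ []))
        , (λ e → contradiction e 1+n≢n) , tt) ∷ []))
  where
  blocks : List Block
  blocks = (1 + b , auxiliary m) ∷ []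

mutual
  -- Labels are distinct for distinct nodes but shared by all calls of one node. The order of the
  -- traces therefore matters: the intended child must precede every other later block with its
  -- label.
  complete : ∀ {k} {f : Code k} {xs v} → Eval f xs v → ∀ b → Trace f b xs v
  complete {xs = xs} ezer b = leaf {m = 0} refl refl (sym (claim-value 0 xs [])) refl
  complete (esuc {x}) b =
    leaf {m = suc x} refl refl (sym (claim-value (suc x) (x ∷ []) []))
      (cong suc (sym (countAt (claim-arguments (suc x) (x ∷ []) []) fzero)))
  complete (eproj {i = i} {xs}) b =
    leaf {m = lookup xs i} refl refl (sym (claim-value (lookup xs i) xs []))
      (sym (countAt (claim-arguments (lookup xs i) xs []) i))
  complete {k} (ecomp {m = m} {f} {gs} {xs} {ys} {v} egs ef) b
    with complete ef (1 + b) | completeV egs (limit f (1 + b))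
  ... | trace {tf} {bf} vf af wf cf | traceV {bg} wg cg calls =
    -- The label ranges of `f` and `gs` are disjoint, so the search for the block of `f` passes over
    -- all of `bg`.
    trace (claim-value v xs (toList ys)) args
      (Allₚ.++⁺ (widen (<⇒≤ b<F) ≤-refl wg) (widen (n≤1+n b) F≤G wf'))
      (((λ _ → here ((tf , next-f , trans vf (sym (claim-value v xs (toList ys))))
                     ∷ Allₚ.++⁺ (copies-hold next-f extra af)
                                (All.map (λ {c} → holdsB-++ df c) (calls args extra))))
        , checkedB-++ {bg} (checkedB-other (unequal (above b<F wg)))
                           (checkedB-other (unequal (above ≤-refl wf'))))
       ∷ Allₚ.++⁺
           (allChecked-++ {(b , ts) ∷ []} (allChecked-below cfw (≤-refl ∷ []))
             (allChecked-++ {bg} (allChecked-above cfw (above ≤-refl wg)) cf))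
           (allChecked-++ {(b , ts) ∷ []} (allChecked-below cgw (b<F ∷ []))
             (allChecked-++ {bg} cg (allChecked-below cgw (below ≤-refl wf')))))
    where
    F = limit f (1 + b)
    ts = claim v xs (toList ys)
    df = (1 + b , tf) ∷ bf
    F≤G = limits-≥ gs F
    b<F : b < F
    b<F = <-trans (n<1+n b) (limit-> f (1 + b))
    wf' = with-self {ts = tf} f wf
    cfw = checks-within f (1 + b)
    cgw = checksV-within gs F
    args = claim-arguments v xs (toList ys)
    next-f : Next (1 + b) (bg ++ df) tf
    next-f = next-skip (All.map >⇒≢ (above (limit-> f (1 + b)) wg)) here
    extra : RegistersB ts (1 + k) ys
    extra = registersB λ i →
      trans (cong (λ j → count (suc j) ts) (+-comm k (toℕ i)))
        (trans (claim-extra v xs (toList ys) (toℕ i))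
          (trans (cong (λ zs → valueOf zs (toℕ i)) (sym (++-identityʳ (toList ys)))) (valueOf-toList ys [] i)))
  complete (eprec0 {f = f} {g} {xs} {v} ef) b with complete ef (2 + b)
  ... | trace {tf} {bf} vf af wf cf =
    trace (claim-value v (0 ∷ xs) []) args
      ((n≤1+n b , ≤-trans (<⇒≤ (limit-> f (2 + b))) (<⇒≤ F<G))
       ∷ widen (m≤n+m b 2) (<⇒≤ F<G) wf')
      (((λ _ → here ((_ , here , sym (countAt args fzero))
                     ∷ (_ , here , refl)
                     ∷ (_ , next-f , trans vf (sym (claim-value v (0 ∷ xs) [])))
                     ∷ copies-hold next-f (tail-registers args) af))
        , (λ e → contradiction e 1+n≢n) , checkedB-other (unequal (above (n≤1+n _) wf')))
       ∷ Allₚ.++⁺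
           (allChecked-++ {(b , ts) ∷ (1 + b , auxiliary 0) ∷ []}
             (allChecked-below cfw (n≤1+n _ ∷ ≤-refl ∷ [])) cf)
           (allChecked-below cgw
             (<-trans (n<1+n b) (<-trans (n<1+n _) (limit-> f (2 + b)))
              ∷ <-trans (n<1+n _) (limit-> f (2 + b)) ∷ below ≤-refl wf')))
    where
    F = limit f (2 + b)
    F<G = limit-> g F
    ts = claim v (0 ∷ xs) []
    wf' = with-self {ts = tf} f wf
    cfw = checks-within f (2 + b)
    cgw = checks-within g F
    args = claim-arguments v (0 ∷ xs) []
    next-f : Next (2 + b) ((1 + b , auxiliary 0) ∷ (2 + b , tf) ∷ bf) tf
    next-f = there (<⇒≢ ≤-refl) here
  complete (eprecS {f = f} {g} {xs} {y} {w} {v} ep eg) b with complete ep b | complete eg (limit f (2 + b))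
  ... | trace {tp} {bp} vp ap wp (cp ∷ cps) | trace {tg} {bg} vg ag wg cg =
    -- The trace for `g` precedes the recursive one, which may itself contain blocks labelled `F`;
    -- nothing in the trace for `g` is labelled `b`.
    trace (claim-value v (suc y ∷ xs) (y ∷ w ∷ [])) args
      ((n≤1+n b , ≤-trans (≤-trans (n≤1+n _) (limit-> f (2 + b))) (<⇒≤ F<G))
       ∷ Allₚ.++⁺ (widen (<⇒≤ b<F) ≤-refl wg') (with-self {ts = tp} (prec f g) wp))
      (((λ _ → there (here ((_ , here , trans (count-auxiliary (suc y)) (sym (countAt args fzero)))
                            ∷ (_ , here , trans (count-auxiliary (suc y)) (cong suc (sym extra₀)))
                            ∷ (_ , next-g , trans (countAt ag fzero) (sym extra₀))
                            ∷ (_ , next-g , trans (countAt ag (fsuc fzero)) (sym extra₁))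
                            ∷ (_ , next-g , trans vg (sym (claim-value v (suc y ∷ xs) (y ∷ w ∷ []))))
                            ∷ (_ , next-p , trans (countAt ap fzero) (sym extra₀))
                            ∷ (_ , next-p , trans vp (sym extra₁))
                            ∷ Allₚ.++⁺ (copies-hold next-g (tail-registers args) (registersB λ i → countAt ag (fsuc (fsuc i))))
                                       (copies-hold next-p (tail-registers args) (tail-registers ap)))))
        , (λ e → contradiction e 1+n≢n)
        , checkedB-++ {dg} (checkedB-other (unequal (above b<F wg'))) cp)
       ∷ Allₚ.++⁺
           (allChecked-++ {prefix} (allChecked-below cfw (n≤1+n _ ∷ ≤-refl ∷ []))
             (allChecked-++ {dg} (allChecked-above cfw (above ≤-refl wg')) cps-f))
           (allChecked-++ {prefix} (allChecked-below cgw (b<F ∷ 1+b<F ∷ []))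
             (allChecked-++ {dg} cg cps-g)))
    where
    F = limit f (2 + b)
    F<G = limit-> g F
    1+b<F : 1 + b < F
    1+b<F = <-trans (n<1+n _) (limit-> f (2 + b))
    b<F : b < F
    b<F = <-trans (n<1+n b) 1+b<F
    ts = claim v (suc y ∷ xs) (y ∷ w ∷ [])
    prefix = (b , ts) ∷ (1 + b , auxiliary (suc y)) ∷ []
    dg = (F , tg) ∷ bg
    dp = (b , tp) ∷ bp
    wg' = with-self {ts = tg} g wg
    cfw = checks-within f (2 + b)
    cgw = checks-within g F
    cps-f = Allₚ.++⁻ˡ (checks f (2 + b)) cps
    cps-g = Allₚ.++⁻ʳ (checks f (2 + b)) cps
    args = claim-arguments v (suc y ∷ xs) (y ∷ w ∷ [])
    extra₀ = claim-extra v (suc y ∷ xs) (y ∷ w ∷ []) 0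
    extra₁ = claim-extra v (suc y ∷ xs) (y ∷ w ∷ []) 1
    next-g : Next F ((1 + b , auxiliary (suc y)) ∷ dg ++ dp) tg
    next-g = there (<⇒≢ 1+b<F) here
    next-p : Next b ((1 + b , auxiliary (suc y)) ∷ dg ++ dp) tp
    next-p = there 1+n≢n (next-skip (unequal (above b<F wg')) here)
  complete (emu {f = f} {xs} {n} ef pos) b
    with complete ef (3 + b)
       | completePositiveBelow f b xs n (λ m m<n → proj₁ (pos m m<n) , complete (proj₂ (pos m m<n)) (3 + b))
  ... | trace {tf} {bf} vf af wf cf | positiveBelow {tm} {bm} am wm (cm ∷ cm' ∷ cms) =
    -- The trace for `f` at `n` comes first, since for positive `n` the chain below it has blocks
    -- labelled `3 + b` of its own.
    trace (claim-value n xs []) args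
      (Allₚ.++⁺ (widen (m≤n+m b 3) ≤-refl wf')
                ((n≤1+n b , ≤-trans (n≤1+n _) (<⇒≤ (limit-> f (3 + b)))) ∷ wm))
      (((λ _ → here ((_ , here , trans (countAt af fzero) (sym (claim-value n xs [])))
                     ∷ (_ , here , vf)
                     ∷ (_ , next-m , trans (countAt am fzero) (sym (claim-value n xs [])))
                     ∷ Allₚ.++⁺ (copies-hold here args (tail-registers af))
                                (copies-hold next-m args (tail-registers am))))
        , checkedB-++ {df} (checkedB-other (unequal (above (m≤n+m _ 2) wf'))) cm)
       ∷ ((λ e → contradiction (sym e) 1+n≢n)
        , checkedB-++ {df} (checkedB-other (unequal (above (n≤1+n _) wf'))) cm')
       ∷ allChecked-++ {(b , claim n xs []) ∷ []} (allChecked-below (checks-within f (3 + b)) (m≤n+m _ 2 ∷ []))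
           (allChecked-++ {df} cf cms))
    where
    df = (3 + b , tf) ∷ bf
    wf' = with-self {ts = tf} f wf
    args = claim-arguments n xs []
    next-m : Next (1 + b) (df ++ (1 + b , tm) ∷ bm) tm
    next-m = next-skip (unequal (above (n≤1+n _) wf')) here

  completeV : ∀ {k m} {gs : Vec (Code k) m} {xs ys} → EvalV gs xs ys → ∀ b → TraceV gs b xs ys
  completeV [] b = traceV [] [] λ _ _ → []
  completeV {k} (_∷_ {g = g} {gs} {xs} {y} {ys} eg egs) b with complete eg b | completeV egs (limit g b)
  ... | trace {tg} {bg} vg ag wg cg | traceV {bs} wgs cgs calls =
    traceV (Allₚ.++⁺ (widen ≤-refl (limits-≥ gs G) wg') (widen (<⇒≤ (limit-> g b)) ≤-refl wgs))
      (Allₚ.++⁺ (allChecked-++ {dg} cg (allChecked-above (checks-within g b) (above ≤-refl wgs)))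
                (allChecked-++ {dg} (allChecked-below (checksV-within gs G) (below ≤-refl wg')) cgs))
      λ {ts} {a} rx ry →
        (_ , here , trans vg (trans (sym (countAt ry fzero)) (cong (λ i → count i ts) (+-identityʳ a))))
        ∷ Allₚ.++⁺ (copies-hold here rx ag)
            (All.zipWith (λ { {c} (t , h) → holdsB-skip c (below ≤-refl wg') t h })
              (valueCmps-target gs (suc a) G ,
               calls rx (registersB λ i → trans (cong (λ j → count j ts) (sym (+-suc a (toℕ i)))) (countAt ry (fsuc i)))))
    where
    G = limit g b
    dg = (b , tg) ∷ bg
    wg' = with-self {ts = tg} g wg

  -- The hypothesis supplies traces instead of derivations: `complete` is then called only on
  -- components of the given derivation, and the recursion here runs on `n` alone.
  completePositiveBelow : ∀ {k} (f : Code (suc k)) b xs n →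
                          (∀ m → m < n → Σ ℕ λ v → Trace f (3 + b) (m ∷ xs) (suc v)) → PositiveBelow f b xs n
  completePositiveBelow f b xs zero _ =
    positiveBelow {blocks = (2 + b , auxiliary 0) ∷ []} args ((m≤n+m b 2 , <⇒≤ (limit-> f (3 + b))) ∷ [])
      (((λ e → contradiction e 1+n≢n) , (λ e → contradiction e (>⇒≢ (n≤1+n _))) , tt)
       ∷ ((λ _ → here ((_ , here , sym (countAt args fzero)) ∷ (_ , here , refl) ∷ []))
          , (λ e → contradiction e 1+n≢n) , tt)
       ∷ allChecked-below (checks-within f (3 + b)) (n≤1+n _ ∷ ≤-refl ∷ []))
    where
    args = claim-arguments 0 (0 ∷ xs) []
  completePositiveBelow f b xs (suc n) pos
    with pos n ≤-refl | completePositiveBelow f b xs n (λ m m<n → pos m (≤-trans m<n (n≤1+n n)))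
  ... | v , trace {tf} {bf} vf af wf cf | positiveBelow {tm} {bm} am wm (cm ∷ cm' ∷ cms) =
    positiveBelow args
      ((m≤n+m b 2 , <⇒≤ (limit-> f (3 + b)))
       ∷ Allₚ.++⁺ (widen (m≤n+m b 3) ≤-refl wf')
                  ((n≤1+n b , ≤-trans (n≤1+n _) (<⇒≤ (limit-> f (3 + b)))) ∷ wm))
      (((λ e → contradiction e 1+n≢n) , (λ e → contradiction e (>⇒≢ (n≤1+n _)))
        , checkedB-++ {df} (checkedB-other (unequal (above (m≤n+m _ 2) wf'))) cm)
       ∷ ((λ _ → there (here ((_ , here , trans (count-auxiliary (suc n)) (sym (countAt args fzero)))
                              ∷ (_ , here , trans (count-auxiliary (suc n)) (cong suc (sym extra₀)))
                              ∷ (_ , next-f , trans (countAt af fzero) (sym extra₀))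
                              ∷ (_ , next-f , trans vf (cong suc (sym extra₁)))
                              ∷ (_ , next-m , trans (countAt am fzero) (sym extra₀))
                              ∷ Allₚ.++⁺ (copies-hold next-f (tail-registers args) (tail-registers af))
                                         (copies-hold next-m (tail-registers args) (tail-registers am)))))
          , (λ e → contradiction e 1+n≢n)
          , checkedB-++ {df} (checkedB-other (unequal (above (n≤1+n _) wf'))) cm')
       ∷ allChecked-++ {(1 + b , claim 0 (suc n ∷ xs) (n ∷ v ∷ [])) ∷ (2 + b , auxiliary (suc n)) ∷ []}
           (allChecked-below (checks-within f (3 + b)) (n≤1+n _ ∷ ≤-refl ∷ []))
           (allChecked-++ {df} cf cms))
    where
    df = (3 + b , tf) ∷ bf
    wf' = with-self {ts = tf} f wf
    args = claim-arguments 0 (suc n ∷ xs) (n ∷ v ∷ [])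
    extra₀ = claim-extra 0 (suc n ∷ xs) (n ∷ v ∷ []) 0
    extra₁ = claim-extra 0 (suc n ∷ xs) (n ∷ v ∷ []) 1
    next-f : Next (3 + b) ((2 + b , auxiliary (suc n)) ∷ df ++ (1 + b , tm) ∷ bm) tf
    next-f = there (<⇒≢ ≤-refl) here
    next-m : Next (1 + b) ((2 + b , auxiliary (suc n)) ∷ df ++ (1 + b , tm) ∷ bm) tm
    next-m = there 1+n≢n (next-skip (unequal (above (n≤1+n _) wf')) here)

-- Uniqueness of values, and codes that compute formula numbers.

mutual
  eval-unique : ∀ {k} {f : Code k} {xs v w} → Eval f xs v → Eval f xs w → v ≡ w
  eval-unique ezer ezer = refl
  eval-unique esuc esuc = refl
  eval-unique eproj eproj = refl
  eval-unique (ecomp gs f) (ecomp gs' f') with evalV-unique gs gs'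
  ... | refl = eval-unique f f'
  eval-unique (eprec0 f) (eprec0 f') = eval-unique f f'
  eval-unique (eprecS p g) (eprecS p' g') with eval-unique p p'
  ... | refl = eval-unique g g'
  eval-unique (emu {n = n} f pos) (emu {n = n'} f' pos') with <-cmp n n'
  -- The smaller zero contradicts the positivity recorded below the larger one.
  ... | tri< n<n' _ _ = contradiction (eval-unique f (proj₂ (pos' n n<n'))) λ ()
  ... | tri≈ _ n≡n' _ = n≡n'
  ... | tri> _ _ n'<n = contradiction (eval-unique (proj₂ (pos n' n'<n)) f') λ ()

  evalV-unique : ∀ {k m} {gs : Vec (Code k) m} {xs ys zs} → EvalV gs xs ys → EvalV gs xs zs → ys ≡ zs
  evalV-unique []       []         = refl
  evalV-unique (e ∷ es) (e' ∷ es') = cong₂ _∷_ (eval-unique e e') (evalV-unique es es')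

numeral : ∀ {k} → ℕ → Code k
numeral zero    = zer
numeral (suc n) = comp suc′ (numeral n ∷ [])

eval-numeral : ∀ {k} {xs : Vec ℕ k} n → Eval (numeral n) xs n
eval-numeral zero    = ezer
eval-numeral (suc n) = ecomp (eval-numeral n ∷ []) esuc

addCode : Code 2
addCode = prec (proj fzero) (comp suc′ (proj (fsuc fzero) ∷ []))

eval-add : ∀ a b → Eval addCode (a ∷ b ∷ []) (a + b)
eval-add zero    b = eprec0 eproj
eval-add (suc a) b = eprecS (eval-add a b) (ecomp (eproj ∷ []) esuc)

-- `pair 0 b` is `suc (b + b)`, and each unit of the first argument doubles the result.
pairCode : Code 2
pairCode = prec (comp suc′ (comp addCode (proj fzero ∷ proj fzero ∷ []) ∷ []))
                (comp addCode (proj (fsuc fzero) ∷ proj (fsuc fzero) ∷ []))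

eval-pair : ∀ a b → Eval pairCode (a ∷ b ∷ []) (pair a b)
eval-pair zero b =
  subst (Eval pairCode (0 ∷ b ∷ []))
    (trans (cong (λ c → suc (b + c)) (sym (+-identityʳ b))) (sym (+-identityʳ (suc (2 * b)))))
    (eprec0 (ecomp (ecomp (eproj ∷ eproj ∷ []) (eval-add b b) ∷ []) esuc))
eval-pair (suc a) b =
  subst (Eval pairCode (suc a ∷ b ∷ []))
    (trans (cong (pair a b +_) (sym (+-identityʳ (pair a b)))) (sym (*-assoc 2 (2 ^ a) (suc (2 * b)))))
    (eprecS (eval-pair a b) (ecomp (eproj ∷ eproj ∷ []) (eval-add (pair a b) (pair a b))))

-- The number of a formula with number `z` behind `x` diamonds of the automaton with number `a`; 4
-- is the tag of the diamond in `encF`.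
inputNumber : ℕ → ℕ → ℕ → ℕ
inputNumber a z zero    = z
inputNumber a z (suc x) = pair 4 (pair a (inputNumber a z x))

inputCode : Code 3
inputCode =
  prec (proj (fsuc fzero))
       (comp pairCode (numeral 4 ∷ comp pairCode (proj (fsuc (fsuc fzero)) ∷ proj (fsuc fzero) ∷ []) ∷ []))

eval-input : ∀ x a z → Eval inputCode (x ∷ a ∷ z ∷ []) (inputNumber a z x)
eval-input zero    a z = eprec0 eproj
eval-input (suc x) a z =
  eprecS (eval-input x a z)
    (ecomp (eval-numeral 4 ∷ ecomp (eproj ∷ eproj ∷ []) (eval-pair a (inputNumber a z x)) ∷ []) (eval-pair 4 _))

-- `x` occurs twice, as the number of the first conjunct and as the input written by the second; 2
-- is the tag of conjunction.
diagonalNumber : ℕ → ℕ → ℕ → ℕ → ℕ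
diagonalNumber x n a z = pair n (pair 2 (pair x (inputNumber a z x)))

diagonalCode : Code 4
diagonalCode =
  comp pairCode
    (proj (fsuc fzero)
     ∷ comp pairCode
         (numeral 2
          ∷ comp pairCode
              (proj fzero
               ∷ comp inputCode (proj fzero ∷ proj (fsuc (fsuc fzero)) ∷ proj (fsuc (fsuc (fsuc fzero))) ∷ [])
               ∷ [])
          ∷ [])
     ∷ [])

eval-diagonal : ∀ x n a z → Eval diagonalCode (x ∷ n ∷ a ∷ z ∷ []) (diagonalNumber x n a z)
eval-diagonal x n a z =
  ecomp (eproj
         ∷ ecomp (eval-numeral 2
                  ∷ ecomp (eproj ∷ ecomp (eproj ∷ eproj ∷ eproj ∷ []) (eval-input x a z) ∷ [])
                          (eval-pair x (inputNumber a z x))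
                  ∷ [])
                 (eval-pair 2 _)
         ∷ [])
        (eval-pair n _)

-- The formula that prescribes the input.

oneState : Bool → ℕ
oneState true  = 1
oneState false = 4

-- Accepts the infixes consisting of one letter that satisfies p.
oneδ : ∀ {n} → (Letter n → Bool) → Transition n
oneδ p 0 a X = oneState (p a) , X ∷ []
oneδ p _ a X = 4 , X ∷ []

one-dead : ∀ {n} {α : Word n} {p s k l} → ¬ Path (oneδ p) α 1 4 s k l
one-dead (move _ _ r) = one-dead r

one-elim : ∀ {n} {α : Word n} {p k l} → Accepts (oneδ p) 1 α k l → p (α k) ≡ true × l ≡ suc k
one-elim {α = α} {p} {k} (move _ _ r) with p (α k)
... | false = ⊥-elim (one-dead r)
... | true  = refl , last r
  where
  last : ∀ {s k l} → Path (oneδ p) α 1 1 s k l → l ≡ k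
  last stop         = refl
  last (move _ _ r) = ⊥-elim (one-dead r)

one-intro : ∀ {n} {α : Word n} {p k} → p (α k) ≡ true → Accepts (oneδ p) 1 α k (suc k)
one-intro e = moveTo (s≤s z≤n) (s≤s z≤n) (cong (λ b → oneState b , 0 ∷ []) e) stop

inputTick : ∀ {n} → Letter n → Bool
inputTick a = not (mark a) ∧ register 0 a

inputPDA endPDA : ∀ {n} → PDA n
inputPDA = automaton (oneδ inputTick) 1
endPDA   = automaton (oneδ mark) 1

-- Iterating one fixed diamond lets the formula number be computed from `x` by one pairing step per
-- unit; a constant pushed by an automaton would enter many rules of its table.
repeatF : ∀ {n} → PDA n → Formula n → ℕ → Formula n
repeatF A φ zero    = φ
repeatF A φ (suc x) = ⟨ A ⟩ repeatF A φ x

endF : ∀ {n} → Formula (suc n)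
endF = ⟨ endPDA ⟩ ⊤f

-- The first block consists of exactly x input letters.
inputF : ∀ {n} → ℕ → Formula (suc n)
inputF = repeatF inputPDA endF

inputTick-elim : ∀ {n} (a : Letter n) → inputTick a ≡ true → mark a ≡ false × register 0 a ≡ true
inputTick-elim a e with mark a | register 0 a
... | false | true = refl , refl

inputF-elim : ∀ {n} {α : Word (suc n)} x {k} → α , k ⊨ inputF x → Reg α (register 0) k x
inputF-elim zero h with ⟨⟩-elim {δ = oneδ mark} {φ = ⊤f} h
... | _ , p , _ = _ , end (proj₁ (one-elim p))
inputF-elim {α = α} (suc x) {k} h with ⟨⟩-elim {δ = oneδ inputTick} {φ = inputF x} h
... | _ , p , h' with one-elim p
... | e , refl = _ , hit (proj₁ (inputTick-elim (α k) e)) (proj₂ (inputTick-elim (α k) e)) (proj₂ (inputF-elim x h'))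

inputF-intro : ∀ {n} {α : Word (suc n)} x {k bs} → 0 < n → Reads α k (auxiliary x) bs → α , k ⊨ inputF x
inputF-intro zero {bs = bs} _ r = ⟨⟩-intro {δ = oneδ mark} {φ = ⊤f} (one-intro (marked bs r)) ⊤f-true
inputF-intro (suc x) 0<n r =
  ⟨⟩-intro {δ = oneδ inputTick} {φ = inputF x}
    (one-intro (trans (cong inputTick (letterAt r 0)) (bit-tabulate (_≡ᵇ 0) 0<n)))
    (inputF-intro x 0<n (reads-tick r))

inputF-wf : ∀ {n} x → WF (inputF {n} x)
inputF-wf zero    = automaton-wf (oneδ mark) 1 , noRun-wf , tt
inputF-wf (suc x) = automaton-wf (oneδ inputTick) 1 , inputF-wf x

-- Stated for variable A, φ and ψ so that type checking never evaluates a concrete encoding.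
encF-repeatF : ∀ {n} (A : PDA n) φ x → encF (repeatF A φ x) ≡ inputNumber (encA A) (encF φ) x
encF-repeatF A φ zero    = refl
encF-repeatF A φ (suc x) = cong (λ y → pair 4 (pair (encA A) y)) (encF-repeatF A φ x)

eval-diagonalFormula : ∀ {n} (A : PDA n) φ ψ →
  Eval diagonalCode (encF ψ ∷ n ∷ encA A ∷ encF φ ∷ []) ⌜ n , ψ ∧f repeatF A φ (encF ψ) ⌝
eval-diagonalFormula {n} A φ ψ =
  subst (λ y → Eval diagonalCode (encF ψ ∷ n ∷ encA A ∷ encF φ ∷ []) (pair n (pair 2 (pair (encF ψ) y))))
    (sym (encF-repeatF A φ (encF ψ)))
    (eval-diagonal (encF ψ) n (encA A) (encF φ))

-- The template and the diagonal argument.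

module Template (code : Code 4) where

  -- The base is 1 because label 0 belongs to the filler after the last block.
  conditions : List Check
  conditions = checks code 1

  -- 6 is the largest `cmpSize` in `root`, that of the comparison with register 4.
  size : ℕ
  size = 6 + sum (map checkSize conditions)

  -- The letters before the first mark form an unlabelled block with the input in register 0. It is
  -- compared with the first block labelled 1, the root of the derivation.
  root : ℕ → ℕ → ℕ → List Cmp
  root m₁ m₂ m₃ = cmp (just 0) 0 1 1 ∷ cmp nothing m₁ 1 2 ∷ cmp nothing m₂ 1 3
       ∷ cmp nothing m₃ 1 4 ∷ cmp nothing 0 1 0 ∷ []

  template : ∀ {n} → ℕ → ℕ → ℕ → Formula (suc n)
  template m₁ m₂ m₃ = ⋀ cmpF (root m₁ m₂ m₃) ∧f ⋀ checkF conditions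

  template-wf : ∀ {n} m₁ m₂ m₃ → WF (template {n} m₁ m₂ m₃)
  template-wf m₁ m₂ m₃ = ⋀-wf {F = cmpF} cmpF-wf (root m₁ m₂ m₃) , ⋀-wf {F = checkF} checkF-wf conditions

  satisfiable⇒eval : ∀ {n} m₁ m₂ m₃ x → Satisfiable (template {n} m₁ m₂ m₃ ∧f inputF x) →
                     Eval code (x ∷ m₁ ∷ m₂ ∷ m₃ ∷ []) 0
  satisfiable⇒eval m₁ m₂ m₃ x (α , (r , h) , i) with ⋀-elim {F = cmpF} {P = Holds α 0} (λ {c} → cmpF-elim c) (root m₁ m₂ m₃) r
  ... | h₁ ∷ h₂ ∷ h₃ ∷ h₄ ∷ h₅ ∷ [] with childOf h₁
  ... | _ , ch , at =
    sound code 1 (⋀-elim {F = checkF} (λ {c} → checkF-elim c) conditions h) at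
      (registers λ { fzero → transfer h₁ (inputF-elim x i) ch
                   ; (fsuc fzero) → transfer-constant h₂ ch
                   ; (fsuc (fsuc fzero)) → transfer-constant h₃ ch
                   ; (fsuc (fsuc (fsuc fzero))) → transfer-constant h₄ ch })
      (transfer-constant h₅ ch)

  eval⇒satisfiable : ∀ {n} → size ≤ n → ∀ m₁ m₂ m₃ x → Eval code (x ∷ m₁ ∷ m₂ ∷ m₃ ∷ []) 0 →
                     Satisfiable (template {n} m₁ m₂ m₃ ∧f inputF x)
  eval⇒satisfiable {n} size≤n m₁ m₂ m₃ x e with complete e 1
  ... | trace {td} {bd} v a w ch =
    α , (⋀-intro {F = cmpF} (λ {c} → cmpF-intro c)
           ( rootHolds (m≤n+m 3 3) (trans (countAt a fzero) (sym (count-auxiliary x)))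
           ∷ rootHolds (m≤n+m 4 2) (trans (countAt a (fsuc fzero)) (sym (+-identityʳ _)))
           ∷ rootHolds (m≤n+m 5 1) (trans (countAt a (fsuc (fsuc fzero))) (sym (+-identityʳ _)))
           ∷ rootHolds ≤-refl (trans (countAt a (fsuc (fsuc (fsuc fzero)))) (sym (+-identityʳ _)))
           ∷ rootHolds (m≤n+m 2 4) v
           ∷ [])
        , ⋀-intro {F = checkF} (λ {c} → checkF-intro c)
            (All.zipWith (λ { {c} (size≤ , (0<g , _) , h) →
                checked-complete c 0<g size≤ reading h })
              (sum-bounds checkSize conditions (m+n≤o⇒n≤o 6 size≤n) , All.zip (checks-within code 1 , ch))))
      , inputF-intro x (≤-trans (s≤s z≤n) 6≤n) reading
    where
    6≤n : 6 ≤ n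
    6≤n = m+n≤o⇒m≤o 6 size≤n
    blocks = (1 , td) ∷ bd
    α : Word (suc n)
    α = wordOf (letters (auxiliary x) blocks)
    reading : Reads α 0 (auxiliary x) blocks
    reading = reads λ i → cong α (+-identityʳ i)
    rootHolds : ∀ {s o d} → cmpSize (cmp s o 1 d) ≤ 6 → count d td ≡ o + sourceCount s (auxiliary x) →
                Holds α 0 (cmp s o 1 d)
    rootHolds {s} {o} {d} size≤6 eq =
      holds-complete (cmp s o 1 d) (≤-trans size≤6 6≤n) reading (td , here , eq)

selfApply : Code 1 → Code 4
selfApply c = comp c (diagonalCode ∷ [])

-- `P` stands for satisfiability of the formula numbered `y`. The answer 0 makes `P` true after all;
-- the answer 1 comes with `P`, which makes `c` return 0 as well, against uniqueness of values.
undecided : ∀ {c y xs} {P : Set} → Eval diagonalCode xs y →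
            (P → Eval (selfApply c) xs 0) → (Eval (selfApply c) xs 0 → P) →
            ¬ ((P × Eval c (y ∷ []) 1) ⊎ (¬ P × Eval c (y ∷ []) 0))
undecided e p⇒0 0⇒p (inj₂ (¬p , e₀)) = ¬p (0⇒p (ecomp (e ∷ []) e₀))
undecided e p⇒0 0⇒p (inj₁ (p , e₁)) with p⇒0 p
... | ecomp (e' ∷ []) e₀ with eval-unique e e'
... | refl = contradiction (eval-unique e₁ e₀) λ ()

diagonalise : ∀ {n} c (A : PDA n) φ (ψ : ℕ → ℕ → ℕ → Formula n) →
  (∀ m₁ m₂ m₃ x → WF (ψ m₁ m₂ m₃ ∧f repeatF A φ x)) →
  (∀ m₁ m₂ m₃ x → Satisfiable (ψ m₁ m₂ m₃ ∧f repeatF A φ x) → Eval (selfApply c) (x ∷ m₁ ∷ m₂ ∷ m₃ ∷ []) 0) →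
  (∀ m₁ m₂ m₃ x → Eval (selfApply c) (x ∷ m₁ ∷ m₂ ∷ m₃ ∷ []) 0 → Satisfiable (ψ m₁ m₂ m₃ ∧f repeatF A φ x)) →
  ¬ DecidesDPLDLSat c
diagonalise {n} c A φ ψ wf sat⇒0 0⇒sat decides =
  undecided (eval-diagonalFormula A φ ψ₀) (sat⇒0 n (encA A) (encF φ) (encF ψ₀)) (0⇒sat n (encA A) (encF φ) (encF ψ₀))
    (decides n (ψ₀ ∧f repeatF A φ (encF ψ₀)) (wf n (encA A) (encF φ) (encF ψ₀)))
  where
  -- `ψ₀` is fixed before its number is used as the input, so no formula has to contain its own
  -- number.
  ψ₀ = ψ n (encA A) (encF φ)

theorem5 : ¬ (Σ (Code 1) DecidesDPLDLSat)
theorem5 (c , decides) =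
  -- One bit for the mark and `size` bits for labels and registers; `size` depends on `c` alone.
  diagonalise c (inputPDA {suc size}) endF template
    (λ m₁ m₂ m₃ x → template-wf m₁ m₂ m₃ , inputF-wf x)
    satisfiable⇒eval (eval⇒satisfiable ≤-refl) decides
  where open Template (selfApply c)
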